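{- For every graph $G$ the following statements are equivalent: (i) $G$ is $\gamma_g$-perfect. (ii) $G$ is $2$-$\gamma_g$-perfect. (iii) $G$ can be obtained (up to isomorphism) from an isolated vertex $K_1$ by repeatedly applying (zero or more times) the following operators: - for a graph $F$ and a positive integer $s$, take the vertex-disjoint union $F\sqcup K_s$; - for a graph $F$ and a perfect set of cliques $\mathcal{Q}$ in $F$, take $\mathcal{O}(F,v,\mathcal{Q})$.
   Context: Graphs are finite, simple, undirected, with at least one vertex, not necessarily connected. $N_G(v)$ and $N_G[v]$ are the open and closed neighborhoods of $v$. $\gamma(G)$ is the domination number of $G$. Domination game on $G$: Dominator and Staller alternately select vertices; each selected vertex must dominate (i.e. contain in its closed neighborhood) at least one vertex not dominated by the previously selected vertices. The game ends when no legal move exists (all vertices are dominated). Dominator wants to minimize and Staller to maximize the total number of moves. $\gamma_g(G)$ is the number of moves under optimal play when Dominator starts. $G$ is $\gamma_g$-perfect if every induced subgraph $F$ of $G$ satisfies $\gamma_g(F)=\gamma(F)$. $G$ is $2$-$\gamma_g$-perfect if every induced subgraph $F$ of $G$ with $\gamma(F)=2$ satisfies $\gamma_g(F)=2$. For $S\subseteq V(G)$, $N_G'(S)=\bigl(\bigcup_{x\in S}N_G[x]\bigr)\setminus S$. A homogeneous clique in $G$ is a (nonempty) clique $Q\subseteq V(G)$ with $N_G[u]=N_G[w]$ for all $u,w\in Q$. The distance $d_G(Q,Q')$ between two vertex sets is the minimum of $d_G(x,x')$ over $x\in Q$, $x'\in Q'$ (vertices in different components are at infinite distance). A perfect set of cliques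 in $G$ is a (possibly empty) set $\mathcal{Q}$ of homogeneous cliques of $G$ such that for every two distinct $Q,Q'\in\mathcal{Q}$ we have $d_G(Q,Q')=3$ and every vertex of $N'_G(Q)$ is adjacent to every vertex of $N'_G(Q')$. In particular the empty set and any set consisting of a single homogeneous clique are perfect sets of cliques. Put $V(\mathcal{Q})=\bigcup_{Q\in\mathcal{Q}}Q$. For a graph $F$, a new vertex $v\notin V(F)$ and a perfect set of cliques $\mathcal{Q}$ in $F$, $\mathcal{O}(F,v,\mathcal{Q})$ is the graph obtained from $F$ by adding the vertex $v$ and making it adjacent to exactly the vertices of $V(F)\setminus V(\mathcal{Q})$. -}

module Defs where

open import Data.Bool using (Bool; true; false; not; T)
open import Data.Fin using (Fin; zero; suc; splitAt)
open import Data.Fin.Properties using (_≟_; any?; all?)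
open import Data.Fin.Subset using (Subset; inside; outside; _∈_; _∉_; ∣_∣; ⁅_⁆; _∪_; ⋃; ∁; Nonempty)
  renaming (⊥ to ∅)
open import Data.Fin.Subset.Properties using (_∈?_)
open import Data.List using (List; []; _∷_; _++_; map; filter; allFin)
open import Data.List.Extrema.Nat using (min; max)
import Data.List.Membership.Propositional as List
open import Data.Nat using (ℕ; zero; suc; _+_; _≤_; NonZero)
open import Data.Product using (∃; ∃₂; _×_)
open import Data.Sum using (_⊎_; inj₁; inj₂)
import Data.Vec as Vec
open import Function.Bundles using (_↣_; _↔_; Injection; Inverse)
open import Relation.Binary.PropositionalEquality using (_≡_; _≢_; refl; sym; cong)
open import Relation.Nullary using (Dec; yes; no; does; ¬?; _×-dec_; contradiction)

record Graph (n : ℕ) : Set where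
  field
    nonEmpty : NonZero n
    adj      : Fin n → Fin n → Bool
    adj-sym  : ∀ u v → adj u v ≡ adj v u
    adj-irr  : ∀ v → adj v v ≡ false

open Graph public

Adj : ∀ {n} → Graph n → Fin n → Fin n → Set
Adj G u v = T (adj G u v)

N[_] : ∀ {n} → Graph n → Fin n → Subset n
N[ G ] v = ⁅ v ⁆ ∪ Vec.tabulate (adj G v)

record _≅_ {m n : ℕ} (G : Graph m) (H : Graph n) : Set where
  field
    bijection : Fin m ↔ Fin n
    preserves : ∀ u v → adj G u v ≡ adj H (Inverse.to bijection u) (Inverse.to bijection v)

-- F ⊑ G: F is, up to the naming of its vertices, an induced subgraph of G.
record _⊑_ {m n : ℕ} (F : Graph m) (G : Graph n) : Set where
  field
    embedding : Fin m ↣ Fin n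
    preserves : ∀ u v → adj F u v ≡ adj G (Injection.to embedding u) (Injection.to embedding v)

infix 4 _≅_ _⊑_

subsets : ∀ n → List (Subset n)
subsets zero    = Vec.[] ∷ []
subsets (suc n) = map (outside Vec.∷_) (subsets n) ++ map (inside Vec.∷_) (subsets n)

Dominating : ∀ {n} → Graph n → Subset n → Set
Dominating G D = ∀ v → ∃ λ u → u ∈ D × v ∈ N[ G ] u

dominating? : ∀ {n} (G : Graph n) (D : Subset n) → Dec (Dominating G D)
dominating? G D = all? λ v → any? λ u → (u ∈? D) ×-dec (v ∈? N[ G ] u)

-- The first argument n of min is the size of the dominating set V(G).
γ : ∀ {n} → Graph n → ℕ
γ {n} G = min n (map ∣_∣ (filter (dominating? G) (subsets n)))

-- A position of the domination game is the set X of vertices dominated so far.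

data Player : Set where
  dominator staller : Player

opponent : Player → Player
opponent dominator = staller
opponent staller   = dominator

Legal : ∀ {n} → Graph n → Subset n → Fin n → Set
Legal G X v = ∃ λ u → u ∈ N[ G ] v × u ∉ X

legal? : ∀ {n} (G : Graph n) (X : Subset n) (v : Fin n) → Dec (Legal G X v)
legal? G X v = any? λ u → (u ∈? N[ G ] v) ×-dec ¬? (u ∈? X)

-- Number of remaining moves for the player to move, given the numbers of
-- moves remaining after each of the legal moves.
optimum : Player → List ℕ → ℕ
optimum _         []       = 0
optimum dominator (k ∷ ks) = suc (min k ks)
optimum staller   (k ∷ ks) = suc (max k ks)

-- The minimax length of the game continued from X with p to move.  The bound
-- on the recursion depth has no effect once it is at least the number of
-- vertices outside X, since each legal move dominates a new vertex.
gameLength : ∀ {n} → Graph n → (bound : ℕ) → Player → Subset n → ℕ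
gameLength     G zero    p X = 0
gameLength {n} G (suc b) p X =
  optimum p (map (λ v → gameLength G b (opponent p) (X ∪ N[ G ] v))
                 (filter (legal? G X) (allFin n)))

γg : ∀ {n} → Graph n → ℕ
γg {n} G = gameLength G n dominator ∅

γg-Perfect : ∀ {n} → Graph n → Set
γg-Perfect G = ∀ {k} (F : Graph k) → F ⊑ G → γg F ≡ γ F

2-γg-Perfect : ∀ {n} → Graph n → Set
2-γg-Perfect G = ∀ {k} (F : Graph k) → F ⊑ G → γ F ≡ 2 → γg F ≡ 2

IsMinimum : (ℕ → Set) → ℕ → Set
IsMinimum P k = P k × (∀ j → P j → k ≤ j)

data Walk {n} (G : Graph n) : Fin n → Fin n → ℕ → Set where
  []  : ∀ {u} → Walk G u u 0
  _∷_ : ∀ {u v w k} → Adj G u v → Walk G v w k → Walk G u w (suc k)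

-- Distances are relations so that an infinite distance is the absence of a
-- value.
Distance : ∀ {n} → Graph n → Fin n → Fin n → ℕ → Set
Distance G u v = IsMinimum (Walk G u v)

SetDistance : ∀ {n} → Graph n → Subset n → Subset n → ℕ → Set
SetDistance G Q Q′ = IsMinimum λ k → ∃₂ λ x x′ → x ∈ Q × x′ ∈ Q′ × Distance G x x′ k

N′ : ∀ {n} → Graph n → Subset n → Fin n → Set
N′ G S v = (∃ λ x → x ∈ S × v ∈ N[ G ] x) × v ∉ S

record HomogeneousClique {n} (G : Graph n) (Q : Subset n) : Set where
  field
    nonempty    : Nonempty Q
    clique      : ∀ {u w} → u ∈ Q → w ∈ Q → u ≢ w → Adj G u w
    homogeneous : ∀ {u w} → u ∈ Q → w ∈ Q → N[ G ] u ≡ N[ G ] w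

-- The list 𝒬 stands for the set of its members; order and repetitions are
-- irrelevant.
record PerfectSetOfCliques {n} (G : Graph n) (𝒬 : List (Subset n)) : Set where
  field
    cliques    : ∀ {Q} → Q List.∈ 𝒬 → HomogeneousClique G Q
    distance-3 : ∀ {Q Q′} → Q List.∈ 𝒬 → Q′ List.∈ 𝒬 → Q ≢ Q′ → SetDistance G Q Q′ 3
    joined     : ∀ {Q Q′} → Q List.∈ 𝒬 → Q′ List.∈ 𝒬 → Q ≢ Q′ →
                 ∀ {x x′} → N′ G Q x → N′ G Q′ x′ → Adj G x x′

K : (s : ℕ) → {{NonZero s}} → Graph s
K s {{s≢0}} = record
  { nonEmpty = s≢0
  ; adj      = λ u v → not (does (u ≟ v))
  ; adj-sym  = λ u v → cong not (≟-sym u v)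
  ; adj-irr  = λ v → cong not (≟-refl v)
  }
  where
  ≟-sym : (u v : Fin s) → does (u ≟ v) ≡ does (v ≟ u)
  ≟-sym u v with u ≟ v | v ≟ u
  ... | yes _   | yes _   = refl
  ... | no _    | no _    = refl
  ... | yes u≡v | no v≢u  = contradiction (sym u≡v) v≢u
  ... | no u≢v  | yes v≡u = contradiction (sym v≡u) u≢v

  ≟-refl : (v : Fin s) → does (v ≟ v) ≡ true
  ≟-refl v with v ≟ v
  ... | yes _  = refl
  ... | no v≢v = contradiction refl v≢v

_⊔ᴳ_ : ∀ {m n} → Graph m → Graph n → Graph (m + n)
_⊔ᴳ_ {m} {n} F H = record
  { nonEmpty = +-nonZero (nonEmpty F)
  ; adj      = λ u v → ⊎-adj (splitAt m u) (splitAt m v)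
  ; adj-sym  = λ u v → ⊎-adj-sym (splitAt m u) (splitAt m v)
  ; adj-irr  = λ v → ⊎-adj-irr (splitAt m v)
  }
  where
  +-nonZero : ∀ {m} → NonZero m → NonZero (m + n)
  +-nonZero {suc _} _ = _

  ⊎-adj : Fin m ⊎ Fin n → Fin m ⊎ Fin n → Bool
  ⊎-adj (inj₁ u) (inj₁ v) = adj F u v
  ⊎-adj (inj₂ u) (inj₂ v) = adj H u v
  ⊎-adj (inj₁ _) (inj₂ _) = false
  ⊎-adj (inj₂ _) (inj₁ _) = false

  ⊎-adj-sym : ∀ x y → ⊎-adj x y ≡ ⊎-adj y x
  ⊎-adj-sym (inj₁ u) (inj₁ v) = adj-sym F u v
  ⊎-adj-sym (inj₂ u) (inj₂ v) = adj-sym H u v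
  ⊎-adj-sym (inj₁ _) (inj₂ _) = refl
  ⊎-adj-sym (inj₂ _) (inj₁ _) = refl

  ⊎-adj-irr : ∀ x → ⊎-adj x x ≡ false
  ⊎-adj-irr (inj₁ v) = adj-irr F v
  ⊎-adj-irr (inj₂ v) = adj-irr H v

-- The new vertex is zero; the vertex u of F becomes suc u.
𝒪 : ∀ {n} → Graph n → List (Subset n) → Graph (suc n)
𝒪 {n} F 𝒬 = record
  { nonEmpty = _
  ; adj      = adj′
  ; adj-sym  = λ { zero zero → refl ; zero (suc _) → refl ; (suc _) zero → refl
                 ; (suc u) (suc v) → adj-sym F u v }
  ; adj-irr  = λ { zero → refl ; (suc v) → adj-irr F v }
  }
  where
  new-adj : Fin n → Bool
  new-adj u = Vec.lookup (∁ (⋃ 𝒬)) u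

  adj′ : Fin (suc n) → Fin (suc n) → Bool
  adj′ zero    zero    = false
  adj′ zero    (suc v) = new-adj v
  adj′ (suc u) zero    = new-adj u
  adj′ (suc u) (suc v) = adj F u v

data Constructible : ∀ {n} → Graph n → Set where
  K₁       : Constructible (K 1)
  add-K    : ∀ {n} {F : Graph n} → Constructible F →
             (s : ℕ) {{_ : NonZero s}} → Constructible (F ⊔ᴳ K s)
  add-𝒪    : ∀ {n} {F : Graph n} → Constructible F →
             (𝒬 : List (Subset n)) → PerfectSetOfCliques F 𝒬 → Constructible (𝒪 F 𝒬)
  relabel  : ∀ {m n} {F : Graph m} {G : Graph n} → F ≅ G → Constructible F → Constructible G

{-# OPTIONS --safe #-}

-- Call a vertex v separating if two non-neighbours of v with a common closed
-- neighbour always have equal closed neighbourhoods, i.e. are twins.  After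
-- the move v every further move then dominates exactly one twin class.
--
-- In a 2-γg-perfect graph every induced subgraph on N[a] ∪ N[b] has a vertex d
-- whose non-neighbours are all twins; taking N[a] ∪ N[b] to meet as many twin
-- classes as possible makes d separating.  As P₅ is excluded as well, deleting
-- either a separating vertex or a component that is a complete graph reverses
-- one of the operators.
--
-- Conversely every induced subgraph of a constructible graph has a separating
-- vertex v.  If k twin classes avoid N[v], then γ ≥ k.  If γ > k, Dominator
-- starts with v.  If γ = k, a minimum dominating set has exactly one vertex in
-- the neighbourhood of each class, and Dominator starts with a member u of it
-- for which N[u] ∩ N[v] is as large as possible; then N[v] ⊆ N[u], and u
-- dominates one of the k classes as well.
module Submission where

open import Defs
open import Data.Bool using (Bool; true; false; T; not)
import Data.Bool.Properties as Bool
open import Data.Empty using (⊥; ⊥-elim)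
open import Data.Fin using (Fin; zero; suc; splitAt; join; _↑ˡ_; _↑ʳ_; punchIn; punchOut)
open import Data.Fin.Properties
  using (_≟_; any?; suc-injective; ↑ˡ-injective; splitAt-↑ˡ; splitAt-↑ʳ; splitAt⁻¹-↑ˡ; splitAt⁻¹-↑ʳ; join-splitAt; punchInᵢ≢i; punchIn-injective; punchIn-punchOut)
open import Data.Fin.Subset
  using (Subset; inside; outside; _∈_; _∉_; _⊆_; ∣_∣; ⁅_⁆; _∪_; _∩_; ∁; ⋃; ⊤; _-_) renaming (⊥ to ∅)
open import Data.Fin.Subset.Properties
open import Data.List using (List; []; _∷_; map; filter; allFin; length; lookup)
open import Data.List.Extrema.Nat
  using (argmax; argmin-sel; argmax-sel; argmax-all; f[xs]≤f[argmax]; min≤v⁺; xs≤max; ⊥≤max)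
import Data.List.Membership.Propositional as List
open import Data.List.Membership.Propositional.Properties
  using (∈-map⁺; ∈-map⁻; ∈-filter⁺; ∈-filter⁻; ∈-allFin; ∈-++⁺ˡ; ∈-++⁺ʳ; ∈-lookup; ∈-cartesianProduct⁺)
import Data.List.Properties as List
open import Data.List.Relation.Unary.AllPairs using ([]; _∷_)
open import Data.List.Relation.Unary.Unique.Propositional using (Unique)
open import Data.List.Relation.Unary.Unique.Propositional.Properties using (allFin⁺; filter⁺)
import Data.List.Relation.Unary.Any.Properties as Any
import Data.List.Membership.DecPropositional as DecMembership
open import Data.List.Relation.Unary.All as All using (All; []; _∷_)
open import Data.List.Relation.Unary.Any as Any using (Any; here; there)
open import Data.Nat using (ℕ; zero; suc; _+_; _≤_; _<_; z≤n; s≤s; s≤s⁻¹; NonZero)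
import Data.Nat.Properties as ℕ
open import Data.Unit using (tt) renaming (⊤ to ⊤₁)
open import Data.Product using (∃; _×_; _,_; proj₁; proj₂)
open import Data.Sum using (_⊎_; inj₁; inj₂; [_,_]′)
import Data.Vec as Vec
import Data.Vec.Properties as Vec
open import Function using (_∘_; id)
open import Function.Bundles using (_⇔_; mk⇔; Equivalence; Injection; mk↣; mk⤖; Inverse)
open import Function.Properties.Bijection using (⤖⇒↔)
open import Relation.Binary.PropositionalEquality
  using (_≡_; _≢_; refl; sym; trans; cong; subst; subst₂)
open import Relation.Nullary using (Dec; yes; no; ¬_; ¬?; contradiction; decidable-stable; _×-dec_)

private variable
  k m n : ℕ

-- Finite subsets and closed neighbourhoods

∈-tabulate⁺ : ∀ {f : Fin n → Bool} {x} → T (f x) → x ∈ Vec.tabulate f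
∈-tabulate⁺ {f = f} {x} fx =
  Vec.lookup⇒[]= x _ (trans (Vec.lookup∘tabulate f x) (Equivalence.to Bool.T-≡ fx))

∈-tabulate⁻ : ∀ {f : Fin n → Bool} {x} → x ∈ Vec.tabulate f → T (f x)
∈-tabulate⁻ {f = f} {x} x∈ =
  Equivalence.from Bool.T-≡ (trans (sym (Vec.lookup∘tabulate f x)) (Vec.[]=⇒lookup x∈))

⟦_⟧ : {P : Fin n → Set} → (∀ x → Dec (P x)) → Subset n
⟦ P? ⟧ = Vec.tabulate (λ x → Dec.does (P? x))

∈⟦⟧⁺ : {P : Fin n → Set} (P? : ∀ x → Dec (P x)) {x : Fin n} → P x → x ∈ ⟦ P? ⟧
∈⟦⟧⁺ P? {x} px = ∈-tabulate⁺ (T-does (P? x))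
  where
  T-does : (d : Dec _) → T (Dec.does d)
  T-does (yes _)  = _
  T-does (no ¬px) = ¬px px

∈⟦⟧⁻ : {P : Fin n → Set} (P? : ∀ x → Dec (P x)) {x : Fin n} → x ∈ ⟦ P? ⟧ → P x
∈⟦⟧⁻ P? {x} x∈ = does-T (P? x) (∈-tabulate⁻ x∈)
  where
  does-T : (d : Dec _) → T (Dec.does d) → _
  does-T (yes px) _ = px

_≟ˢ_ : (p q : Subset n) → Dec (p ≡ q)
_≟ˢ_ = Vec.≡-dec Bool._≟_

Full : Subset n → Set
Full X = ∀ v → v ∈ X

full-size : (X : Subset n) → n ≤ ∣ X ∣ → Full X
full-size X n≤∣X∣ v = subst (v ∈_) (sym (∣p∣≡n⇒p≡⊤ (ℕ.≤-antisym (∣p∣≤n X) n≤∣X∣))) ∈⊤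

∣p∪⁅x⁆∣≤1+∣p∣ : (p : Subset n) (x : Fin n) → ∣ p ∪ ⁅ x ⁆ ∣ ≤ suc ∣ p ∣
∣p∪⁅x⁆∣≤1+∣p∣ (outside Vec.∷ p) zero    = s≤s (ℕ.≤-reflexive (cong ∣_∣ (∪-identityʳ p)))
∣p∪⁅x⁆∣≤1+∣p∣ (inside  Vec.∷ p) zero    =
  s≤s (ℕ.m≤n⇒m≤1+n (ℕ.≤-reflexive (cong ∣_∣ (∪-identityʳ p))))
∣p∪⁅x⁆∣≤1+∣p∣ (outside Vec.∷ p) (suc x) = ∣p∪⁅x⁆∣≤1+∣p∣ p x
∣p∪⁅x⁆∣≤1+∣p∣ (inside  Vec.∷ p) (suc x) = s≤s (∣p∪⁅x⁆∣≤1+∣p∣ p x)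

module _ (G : Graph n) where

  ∈N⁺ : ∀ {x y} → x ≡ y ⊎ Adj G x y → y ∈ N[ G ] x
  ∈N⁺ {x} (inj₁ refl) = x∈p∪q⁺ (inj₁ (x∈⁅x⁆ x))
  ∈N⁺     (inj₂ xy)   = x∈p∪q⁺ (inj₂ (∈-tabulate⁺ xy))

  ∈N⁻ : ∀ {x y} → y ∈ N[ G ] x → x ≡ y ⊎ Adj G x y
  ∈N⁻ {x} y∈ with x∈p∪q⁻ ⁅ x ⁆ _ y∈
  ... | inj₁ y∈⁅x⁆ = inj₁ (sym (x∈⁅y⁆⇒x≡y x y∈⁅x⁆))
  ... | inj₂ y∈tab = inj₂ (∈-tabulate⁻ y∈tab)

  Adj-sym : ∀ {x y} → Adj G x y → Adj G y x
  Adj-sym {x} {y} = subst T (adj-sym G x y)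

  N-refl : ∀ x → x ∈ N[ G ] x
  N-refl x = ∈N⁺ (inj₁ refl)

  N-sym : ∀ {x y} → y ∈ N[ G ] x → x ∈ N[ G ] y
  N-sym y∈ with ∈N⁻ y∈
  ... | inj₁ x≡y = ∈N⁺ (inj₁ (sym x≡y))
  ... | inj₂ xy  = ∈N⁺ (inj₂ (Adj-sym xy))

  -- Since `y ∈ N[ G ] x` is symmetric in `x` and `y`, being twins amounts to lying in the same
  -- closed neighbourhoods; `N-ext` is the converse.
  N-≡ : ∀ {x y t} → N[ G ] x ≡ N[ G ] y → x ∈ N[ G ] t → y ∈ N[ G ] t
  N-≡ Nx≡Ny x∈ = N-sym (subst (_ ∈_) Nx≡Ny (N-sym x∈))

  N-ext : ∀ {x y} → (∀ {t} → x ∈ N[ G ] t → y ∈ N[ G ] t) → (∀ {t} → y ∈ N[ G ] t → x ∈ N[ G ] t) →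
          N[ G ] x ≡ N[ G ] y
  N-ext x⇒y y⇒x = ⊆-antisym (N-sym ∘ x⇒y ∘ N-sym) (N-sym ∘ y⇒x ∘ N-sym)

-- Domination number

subsets-complete : (S : Subset n) → S List.∈ subsets n
subsets-complete Vec.[]              = here refl
subsets-complete (outside Vec.∷ S)   = ∈-++⁺ˡ (∈-map⁺ _ (subsets-complete S))
subsets-complete (inside Vec.∷ S)    = ∈-++⁺ʳ _ (∈-map⁺ _ (subsets-complete S))

γ≤∣D∣ : (G : Graph n) {D : Subset n} → Dominating G D → γ G ≤ ∣ D ∣
γ≤∣D∣ {n} G {D} dom =
  min≤v⁺ n _ (inj₂ (List.lose (∈-map⁺ ∣_∣ (∈-filter⁺ (dominating? G) (subsets-complete D) dom)) ℕ.≤-refl))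

γ-attained : (G : Graph n) → ∃ λ D → Dominating G D × ∣ D ∣ ≡ γ G
γ-attained {n} G with argmin-sel id n (map ∣_∣ (filter (dominating? G) (subsets n)))
-- The default value `n` of the minimum is attained by the whole vertex set.
... | inj₁ γ≡n = ⊤ , (λ v → v , ∈⊤ , N-refl G v) , trans (∣⊤∣≡n n) (sym γ≡n)
... | inj₂ γ∈ with ∈-map⁻ ∣_∣ γ∈
... | D , D∈ , γ≡∣D∣ = D , proj₂ (∈-filter⁻ (dominating? G) {xs = subsets n} D∈) , sym γ≡∣D∣

-- Domination game

optimum-∈ : ∀ p k ks → ∃ λ j → j List.∈ (k ∷ ks) × optimum p (k ∷ ks) ≡ suc j
optimum-∈ dominator k ks with argmin-sel id k ks
... | inj₁ min≡k = k , here refl , cong suc min≡k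
... | inj₂ min∈  = _ , there min∈ , refl
optimum-∈ staller k ks with argmax-sel id k ks
... | inj₁ max≡k = k , here refl , cong suc max≡k
... | inj₂ max∈  = _ , there max∈ , refl

optimum-dominator-≤ : ∀ {j} ks → j List.∈ ks → optimum dominator ks ≤ suc j
optimum-dominator-≤ (k ∷ ks) (here refl) = s≤s (min≤v⁺ k ks (inj₁ ℕ.≤-refl))
optimum-dominator-≤ (k ∷ ks) (there j∈)  = s≤s (min≤v⁺ k ks (inj₂ (List.lose j∈ ℕ.≤-refl)))

optimum-staller-≥ : ∀ {j} ks → j List.∈ ks → suc j ≤ optimum staller ks
optimum-staller-≥ (k ∷ ks) (here refl) = s≤s (⊥≤max k ks)
optimum-staller-≥ (k ∷ ks) (there j∈)  = s≤s (All.lookup (xs≤max k ks) j∈)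

module _ (G : Graph n) where

  after : ℕ → Player → Subset n → Fin n → ℕ
  after b p X v = gameLength G b (opponent p) (X ∪ N[ G ] v)

  moves : Subset n → List (Fin n)
  moves X = filter (legal? G X) (allFin n)

  ∈-moves⁺ : ∀ {X v} → Legal G X v → v List.∈ moves X
  ∈-moves⁺ {X} {v} = ∈-filter⁺ (legal? G X) (∈-allFin v)

  ∈-moves⁻ : ∀ {X v} → v List.∈ moves X → Legal G X v
  ∈-moves⁻ {X} = proj₂ ∘ ∈-filter⁻ (legal? G X) {xs = allFin n}

  -- For either player the value is realized by some legal move. This suffices for every bound that
  -- holds no matter who is choosing.
  Outcome : ℕ → Player → Subset n → Set
  Outcome b p X =
    (Full X × gameLength G (suc b) p X ≡ 0) ⊎
    (∃ λ v → Legal G X v × gameLength G (suc b) p X ≡ suc (after b p X v))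

  outcome : ∀ b p X → Outcome b p X
  outcome b p X with moves X in eq
  ... | [] = inj₁ (full , refl)
    where
    full : Full X
    -- An undominated vertex would itself be a legal move.
    full v = decidable-stable (v ∈? X) λ v∉X →
      contradiction (subst (v List.∈_) eq (∈-moves⁺ (v , N-refl G v , v∉X))) λ ()
  ... | v ∷ vs with optimum-∈ p (after b p X v) (map (after b p X) vs)
  ... | j , j∈ , opt≡ with ∈-map⁻ (after b p X) {xs = v ∷ vs} j∈
  ... | w , w∈ , j≡ = inj₂ (w , ∈-moves⁻ (subst (w List.∈_) (sym eq) w∈) , trans opt≡ (cong suc j≡))

  -- The invariant `n ≤ b + ∣ X ∣` keeps the recursion bound from running out while a vertex is
  -- undominated; a legal move preserves it by dominating a new vertex.
  grow : ∀ {X v b} → Legal G X v → n ≤ suc b + ∣ X ∣ → n ≤ b + ∣ X ∪ N[ G ] v ∣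
  grow {X} {v} {b} (u , u∈Nv , u∉X) n≤ = begin
    n                       ≤⟨ n≤ ⟩
    suc b + ∣ X ∣           ≡⟨ ℕ.+-suc b ∣ X ∣ ⟨
    b + suc ∣ X ∣           ≤⟨ ℕ.+-monoʳ-≤ b (p⊂q⇒∣p∣<∣q∣ (p⊆p∪q _ , u , x∈p∪q⁺ (inj₂ u∈Nv) , u∉X)) ⟩
    b + ∣ X ∪ N[ G ] v ∣    ∎
    where open ℕ.≤-Reasoning

  gameLength≡0⇒Full : ∀ b p X → n ≤ b + ∣ X ∣ → gameLength G b p X ≡ 0 → Full X
  gameLength≡0⇒Full zero    p X n≤ _    = full-size X n≤
  gameLength≡0⇒Full (suc b) p X n≤ len≡0 with outcome b p X
  ... | inj₁ (full , _)     = full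
  ... | inj₂ (_ , _ , len≡) = contradiction (trans (sym len≡0) len≡) λ ()

  -- However the game continues, the vertices still to be played extend `D` to a dominating set.
  γ≤∣D∣+gameLength : ∀ b p X D → n ≤ b + ∣ X ∣ → (∀ {v} → v ∈ X → ∃ λ u → u ∈ D × v ∈ N[ G ] u) →
                     γ G ≤ ∣ D ∣ + gameLength G b p X
  γ≤∣D∣+gameLength zero p X D n≤ dom =
    ℕ.≤-trans (γ≤∣D∣ G (dom ∘ full-size X n≤)) (ℕ.m≤m+n ∣ D ∣ 0)
  γ≤∣D∣+gameLength (suc b) p X D n≤ dom with outcome b p X
  ... | inj₁ (full , _) = ℕ.≤-trans (γ≤∣D∣ G (dom ∘ full)) (ℕ.m≤m+n ∣ D ∣ _)
  ... | inj₂ (v , legal , len≡) = begin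
    γ G                                     ≤⟨ γ≤∣D∣+gameLength b (opponent p) _ (D ∪ ⁅ v ⁆) (grow legal n≤) dom′ ⟩
    ∣ D ∪ ⁅ v ⁆ ∣ + after b p X v           ≤⟨ ℕ.+-monoˡ-≤ _ (∣p∪⁅x⁆∣≤1+∣p∣ D v) ⟩
    suc ∣ D ∣ + after b p X v               ≡⟨ ℕ.+-suc ∣ D ∣ _ ⟨
    ∣ D ∣ + suc (after b p X v)             ≡⟨ cong (∣ D ∣ +_) len≡ ⟨
    ∣ D ∣ + gameLength G (suc b) p X        ∎
    where
    open ℕ.≤-Reasoning
    dom′ : ∀ {w} → w ∈ X ∪ N[ G ] v → ∃ λ u → u ∈ D ∪ ⁅ v ⁆ × w ∈ N[ G ] u
    dom′ w∈ with x∈p∪q⁻ X _ w∈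
    ... | inj₁ w∈X  = let u , u∈D , w∈Nu = dom w∈X in u , x∈p∪q⁺ (inj₁ u∈D) , w∈Nu
    ... | inj₂ w∈Nv = v , x∈p∪q⁺ (inj₂ (x∈⁅x⁆ v)) , w∈Nv

  γ≤γg : γ G ≤ γg G
  γ≤γg = subst (λ s → γ G ≤ s + γg G) (∣⊥∣≡0 n)
    (γ≤∣D∣+gameLength n dominator ∅ ∅ (ℕ.m≤m+n n _) (λ v∈ → contradiction v∈ ∉⊥))

  -- The depth `b` is left existential because `n` is not in successor form; the upper bound on the
  -- rest of the game holds for every depth.
  γg≤1+gameLength : ∀ v → ∃ λ b → γg G ≤ suc (gameLength G b staller (∅ ∪ N[ G ] v))
  γg≤1+gameLength = go n
    where
    go : ∀ b v → ∃ λ b′ → gameLength G b dominator ∅ ≤ suc (gameLength G b′ staller (∅ ∪ N[ G ] v))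
    go zero    v = zero , z≤n
    go (suc b) v = b , optimum-dominator-≤ _ (∈-map⁺ _ (∈-moves⁺ (v , N-refl G v , ∉⊥)))

  -- Any move dominating an undominated vertex also dominates all its twins.
  gameLength≤length : ∀ b p X qs → (∀ {x} → x ∉ X → ∃ λ q → q List.∈ qs × N[ G ] x ≡ N[ G ] q) →
                      gameLength G b p X ≤ length qs
  gameLength≤length zero    p X qs cover = z≤n
  gameLength≤length (suc b) p X qs cover with outcome b p X
  ... | inj₁ (_ , len≡0) = ℕ.≤-trans (ℕ.≤-reflexive len≡0) z≤n
  ... | inj₂ (v , (u , u∈Nv , u∉X) , len≡) = begin
    gameLength G (suc b) p X      ≡⟨ len≡ ⟩
    suc (after b p X v)           ≤⟨ s≤s (gameLength≤length b (opponent p) _ (filter new? qs) cover′) ⟩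
    suc (length (filter new? qs)) ≤⟨ List.filter-notAll new? qs some-old ⟩
    length qs                     ∎
    where
    open ℕ.≤-Reasoning
    new? : ∀ q → Dec (N[ G ] u ≢ N[ G ] q)
    new? q = ¬? (N[ G ] u ≟ˢ N[ G ] q)

    some-old : Any (λ q → ¬ (N[ G ] u ≢ N[ G ] q)) qs
    some-old = let q , q∈ , Nu≡Nq = cover u∉X in List.lose q∈ (λ Nu≢Nq → Nu≢Nq Nu≡Nq)

    cover′ : ∀ {x} → x ∉ X ∪ N[ G ] v → ∃ λ q → q List.∈ filter new? qs × N[ G ] x ≡ N[ G ] q
    cover′ {x} x∉ =
      let q , q∈ , Nx≡Nq = cover (x∉ ∘ x∈p∪q⁺ ∘ inj₁)
      in q , ∈-filter⁺ new? q∈ (λ Nu≡Nq → x∉ (x∈p∪q⁺ (inj₂ (N-≡ G (trans Nu≡Nq (sym Nx≡Nq)) u∈Nv)))) , Nx≡Nq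

  -- After Dominator's optimal move `d`, every legal reply of Staller ends the game. So a vertex `t`
  -- that dominates one non-neighbour of `d` dominates all of them.
  γg≡2⇒twins : γg G ≡ 2 → ∃ λ d → ∀ {x y} → x ∉ N[ G ] d → y ∉ N[ G ] d → N[ G ] x ≡ N[ G ] y
  γg≡2⇒twins = go n (ℕ.m≤m+n n _)
    where
    reply : ∀ b X → n ≤ b + ∣ X ∣ → gameLength G b staller X ≡ 1 → ∀ {t x y} → x ∉ X → y ∉ X →
            x ∈ N[ G ] t → y ∈ N[ G ] t
    reply (suc b) X n≤ len≡1 {t} {x} {y} x∉X y∉X x∈Nt =
      [ (λ y∈X → contradiction y∈X y∉X) , id ]′
        (x∈p∪q⁻ X _ (gameLength≡0⇒Full b dominator _ (grow legal n≤) (ℕ.n≤0⇒n≡0 after≤0) y))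
      where
      legal : Legal G X t
      legal = x , x∈Nt , x∉X
      after≤0 : after b staller X t ≤ 0
      after≤0 = s≤s⁻¹ (ℕ.≤-trans (optimum-staller-≥ _ (∈-map⁺ _ (∈-moves⁺ legal))) (ℕ.≤-reflexive len≡1))

    go : ∀ b → n ≤ b + ∣ ∅ {n} ∣ → gameLength G b dominator ∅ ≡ 2 →
         ∃ λ d → ∀ {x y} → x ∉ N[ G ] d → y ∉ N[ G ] d → N[ G ] x ≡ N[ G ] y
    go (suc b) n≤ len≡2 with outcome b dominator ∅
    ... | inj₁ (_ , len≡0) = contradiction (trans (sym len≡2) len≡0) λ ()
    ... | inj₂ (d , legal , len≡) = d , λ x∉ y∉ → N-ext G (answer x∉ y∉) (answer y∉ x∉)
      where
      ∉∅∪ : ∀ {x} → x ∉ N[ G ] d → x ∉ ∅ ∪ N[ G ] d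
      ∉∅∪ x∉ x∈ = [ ∉⊥ , x∉ ]′ (x∈p∪q⁻ ∅ _ x∈)
      answer : ∀ {t x y} → x ∉ N[ G ] d → y ∉ N[ G ] d → x ∈ N[ G ] t → y ∈ N[ G ] t
      answer x∉ y∉ = reply b _ (grow legal n≤) (ℕ.suc-injective (trans (sym len≡) len≡2)) (∉∅∪ x∉) (∉∅∪ y∉)

-- Induced subgraphs

lookup-injective : ∀ {A : Set} {xs : List A} → Unique xs → ∀ {i j} → lookup xs i ≡ lookup xs j → i ≡ j
lookup-injective (x∉ ∷ u) {zero}  {zero}  _  = refl
lookup-injective (x∉ ∷ u) {zero}  {suc j} eq = contradiction eq (All.lookup x∉ (∈-lookup j))
lookup-injective (x∉ ∷ u) {suc i} {zero}  eq = contradiction (sym eq) (All.lookup x∉ (∈-lookup i))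
lookup-injective (x∉ ∷ u) {suc i} {suc j} eq = cong suc (lookup-injective u eq)

-- A numbering of the vertices in `P`, which turns the subgraph induced on them into a `Graph` on
-- `Fin size`.
record Enumeration (P : Fin n → Set) : Set where
  field
    size         : ℕ
    at           : Fin size → Fin n
    at-injective : ∀ {i j} → at i ≡ at j → i ≡ j
    at-∈         : ∀ i → P (at i)
    index        : ∀ {x} → P x → Fin size
    at-index     : ∀ {x} (px : P x) → at (index px) ≡ x

enumeration : {P : Fin n → Set} → (∀ x → Dec (P x)) → Enumeration P
enumeration {n} P? = record
  { size         = length xs
  ; at           = lookup xs
  ; at-injective = lookup-injective (filter⁺ P? (allFin⁺ n))
  ; at-∈         = λ i → proj₂ (∈-filter⁻ P? {xs = allFin n} (∈-lookup {xs = xs} i))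
  ; index        = λ px → Any.index (x∈xs px)
  ; at-index     = λ px → sym (Any.lookup-index (x∈xs px))
  }
  where
  xs : List (Fin n)
  xs = filter P? (allFin n)
  x∈xs : ∀ {x} → _ → x List.∈ xs
  x∈xs {x} = ∈-filter⁺ P? (∈-allFin x)

inhabited⇒NonZero : Fin n → NonZero n
inhabited⇒NonZero zero    = _
inhabited⇒NonZero (suc _) = _

some-vertex : Graph n → Fin n
some-vertex {zero}  G = contradiction (nonEmpty G) λ ()
some-vertex {suc n} G = zero

-- For injective `f` this is the subgraph induced on the image of `f`.
pullback : Graph n → (Fin k → Fin n) → NonZero k → Graph k
pullback G f k≢0 = record
  { nonEmpty = k≢0
  ; adj      = λ u v → adj G (f u) (f v)
  ; adj-sym  = λ u v → adj-sym G (f u) (f v)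
  ; adj-irr  = λ v → adj-irr G (f v)
  }

⊑-trans : {E : Graph k} {F : Graph m} {G : Graph n} → E ⊑ F → F ⊑ G → E ⊑ G
⊑-trans E⊑F F⊑G = record
  { embedding = mk↣ (Injection.injective E⊑F.embedding ∘ Injection.injective F⊑G.embedding)
  ; preserves = λ u v → trans (E⊑F.preserves u v) (F⊑G.preserves _ _)
  }
  where
  module E⊑F = _⊑_ E⊑F
  module F⊑G = _⊑_ F⊑G

module _ {F : Graph m} {G : Graph n} (F⊑G : F ⊑ G) where
  open _⊑_ F⊑G

  ι : Fin m → Fin n
  ι = Injection.to embedding

  ι-injective : ∀ {x y} → ι x ≡ ι y → x ≡ y
  ι-injective = Injection.injective embedding

  N-ι⁺ : ∀ {x y} → x ∈ N[ F ] y → ι x ∈ N[ G ] (ι y)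
  N-ι⁺ x∈ with ∈N⁻ F x∈
  ... | inj₁ y≡x = ∈N⁺ G (inj₁ (cong ι y≡x))
  ... | inj₂ yx  = ∈N⁺ G (inj₂ (subst T (preserves _ _) yx))

  N-ι⁻ : ∀ {x y} → ι x ∈ N[ G ] (ι y) → x ∈ N[ F ] y
  N-ι⁻ ιx∈ with ∈N⁻ G ιx∈
  ... | inj₁ ιy≡ιx = ∈N⁺ F (inj₁ (ι-injective ιy≡ιx))
  ... | inj₂ yx    = ∈N⁺ F (inj₂ (subst T (sym (preserves _ _)) yx))

2-γg-Perfect-⊑ : {F : Graph m} {G : Graph n} → F ⊑ G → 2-γg-Perfect G → 2-γg-Perfect F
2-γg-Perfect-⊑ F⊑G perfect E E⊑F = perfect E (⊑-trans E⊑F F⊑G)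

-- Separating vertices

maximum-∈ : ∀ {A : Set} (f : A → ℕ) {x xs} → x List.∈ xs →
            ∃ λ y → y List.∈ xs × (∀ {z} → z List.∈ xs → f z ≤ f y)
maximum-∈ f {x} {xs} x∈xs =
  argmax f x xs ,
  argmax-all f {P = List._∈ xs} x∈xs (All.tabulate id) ,
  All.lookup (f[xs]≤f[argmax] x xs)

0<∣p∣ : ∀ {p : Subset n} {x} → x ∈ p → 0 < ∣ p ∣
0<∣p∣ x∈p = ℕ.≤-trans (s≤s z≤n) (x∈p⇒∣p-x∣<∣p∣ x∈p)

∣p∣≤1⇒unique : ∀ {p : Subset n} {x y} → ∣ p ∣ ≤ 1 → x ∈ p → y ∈ p → x ≡ y
∣p∣≤1⇒unique {p = p} {x} {y} ∣p∣≤1 x∈p y∈p = decidable-stable (x ≟ y) λ x≢y →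
  ℕ.<⇒≱ (x∈p⇒∣p-x∣<∣p∣ x∈p) (ℕ.≤-trans ∣p∣≤1 (0<∣p∣ (x∈p∧x≢y⇒x∈p-y y∈p (x≢y ∘ sym))))

Separating : Graph n → Fin n → Set
Separating G v = ∀ {x y t} → x ∉ N[ G ] v → y ∉ N[ G ] v → x ∈ N[ G ] t → y ∈ N[ G ] t →
                 N[ G ] x ≡ N[ G ] y

-- If `γ F` is 2, the game on `F` lasts two moves and yields `d`. If it is smaller, one vertex
-- dominates everything and the condition is vacuous.
γ≤2⇒twins : {G : Graph n} → 2-γg-Perfect G → {F : Graph m} → F ⊑ G → γ F ≤ 2 →
            ∃ λ d → ∀ {x y} → x ∉ N[ F ] d → y ∉ N[ F ] d → N[ F ] x ≡ N[ F ] y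
γ≤2⇒twins perfect {F} F⊑G γ≤2 with γ-attained F
... | D , dom , ∣D∣≡γ with ℕ.m≤n⇒m<n∨m≡n γ≤2
... | inj₂ γ≡2 = γg≡2⇒twins F (perfect F F⊑G γ≡2)
... | inj₁ γ<2 = d , λ x∉ _ → contradiction (universal _) x∉
  where
  ∣D∣≤1 : ∣ D ∣ ≤ 1
  ∣D∣≤1 = subst (_≤ 1) (sym ∣D∣≡γ) (s≤s⁻¹ γ<2)
  d : Fin _
  d = proj₁ (dom (some-vertex F))
  universal : ∀ x → x ∈ N[ F ] d
  universal x =
    let _ , d∈D , _ = dom (some-vertex F) ; u , u∈D , x∈Nu = dom x
    in subst (λ w → x ∈ N[ F ] w) (∣p∣≤1⇒unique ∣D∣≤1 u∈D d∈D) x∈Nu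

module _ (G : Graph n) where

  -- The twin condition in the subgraph induced on `S`. One implication is enough, as `x` and `y`
  -- can be exchanged.
  TwinsOn : (Fin n → Set) → Fin n → Set
  TwinsOn S d = ∀ {x y t} → S x → S y → S t → x ∉ N[ G ] d → y ∉ N[ G ] d → x ∈ N[ G ] t → y ∈ N[ G ] t

  -- The vertices `a` and `b` dominate the subgraph induced on `S`, so its domination number is at
  -- most 2.
  pair-twins : 2-γg-Perfect G → {S : Fin n → Set} (S? : ∀ x → Dec (S x)) → ∀ {a b} → S a → S b →
               (∀ {x} → S x → x ∈ N[ G ] a ∪ N[ G ] b) → ∃ λ d → S d × TwinsOn S d
  pair-twins perfect {S} S? {a} {b} a∈ b∈ S⊆ = at d , at-∈ d , twins
    where
    open Enumeration (enumeration {P = S} S?)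

    F : Graph size
    F = pullback G at (inhabited⇒NonZero (index a∈))

    F⊑G : F ⊑ G
    F⊑G = record { embedding = mk↣ at-injective ; preserves = λ _ _ → refl }

    dom : Dominating F (⁅ index a∈ ⁆ ∪ ⁅ index b∈ ⁆)
    dom i with x∈p∪q⁻ (N[ G ] a) _ (S⊆ (at-∈ i))
    ... | inj₁ i∈Na = index a∈ , x∈p∪q⁺ (inj₁ (x∈⁅x⁆ _)) ,
                      N-ι⁻ F⊑G (subst (λ w → at i ∈ N[ G ] w) (sym (at-index a∈)) i∈Na)
    ... | inj₂ i∈Nb = index b∈ , x∈p∪q⁺ (inj₂ (x∈⁅x⁆ _)) ,
                      N-ι⁻ F⊑G (subst (λ w → at i ∈ N[ G ] w) (sym (at-index b∈)) i∈Nb)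

    γF≤2 : γ F ≤ 2
    γF≤2 = ℕ.≤-trans (γ≤∣D∣ F dom)
      (ℕ.≤-trans (∣p∪⁅x⁆∣≤1+∣p∣ ⁅ index a∈ ⁆ _) (s≤s (ℕ.≤-reflexive (∣⁅x⁆∣≡1 (index a∈)))))

    d : Fin size
    d = proj₁ (γ≤2⇒twins perfect F⊑G γF≤2)

    twins : TwinsOn S (at d)
    twins {x} {y} {t} x∈ y∈ t∈ x∉ y∉ x∈Nt =
      subst₂ (λ u w → u ∈ N[ G ] w) (at-index y∈) (at-index t∈)
        (N-ι⁺ F⊑G (N-≡ F (proj₂ (γ≤2⇒twins perfect F⊑G γF≤2) (∉F x∈ x∉) (∉F y∈ y∉))
          (N-ι⁻ F⊑G (subst₂ (λ u w → u ∈ N[ G ] w) (sym (at-index x∈)) (sym (at-index t∈)) x∈Nt))))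
      where
      ∉F : ∀ {w} (w∈ : S w) → w ∉ N[ G ] (at d) → index w∈ ∉ N[ F ] d
      ∉F w∈ w∉ i∈ = w∉ (subst (_∈ N[ G ] (at d)) (at-index w∈) (N-ι⁺ F⊑G i∈))

  private
    -- The default only makes the function total: being a witness itself, it guarantees that the
    -- search succeeds, and the vertex found depends on `p` alone.
    search : ∀ p → ∃ (λ x → N[ G ] x ≡ p) → ∃ (λ x → N[ G ] x ≡ p)
    search p default with any? (λ x → N[ G ] x ≟ˢ p)
    ... | yes found = found
    ... | no  _     = default

    search-≡ : ∀ {p q} → p ≡ q → ∀ d e → proj₁ (search p d) ≡ proj₁ (search q e)
    search-≡ {p} refl d e with any? (λ x → N[ G ] x ≟ˢ p)
    ... | yes found   = refl
    ... | no  nothing = contradiction d nothing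

  -- Computed from N[x] alone, so that twins have the same representative.
  rep : Fin n → Fin n
  rep x = proj₁ (search (N[ G ] x) (x , refl))

  N-rep : ∀ x → N[ G ] (rep x) ≡ N[ G ] x
  N-rep x = proj₂ (search (N[ G ] x) (x , refl))

  rep-≡ : ∀ {x y} → N[ G ] x ≡ N[ G ] y → rep x ≡ rep y
  rep-≡ Nx≡Ny = search-≡ Nx≡Ny _ _

  rep≡⇒N≡ : ∀ {x y} → rep x ≡ rep y → N[ G ] x ≡ N[ G ] y
  rep≡⇒N≡ {x} {y} eq = trans (sym (N-rep x)) (trans (cong N[ G ] eq) (N-rep y))

  reps : Subset n
  reps = ⟦ (λ x → rep x ≟ x) ⟧

  ∈-reps⁻ : ∀ {x} → x ∈ reps → rep x ≡ x
  ∈-reps⁻ = ∈⟦⟧⁻ (λ x → rep x ≟ x)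

  rep-∈-reps : ∀ x → rep x ∈ reps
  rep-∈-reps x = ∈⟦⟧⁺ (λ y → rep y ≟ y) (rep-≡ (N-rep x))

  -- The number of twin classes meeting U, if U is a union of twin classes.
  μ : Subset n → ℕ
  μ U = ∣ U ∩ reps ∣

  μ-mono : ∀ {U V} → U ⊆ V → μ U ≤ μ V
  μ-mono U⊆V = p⊆q⇒∣p∣≤∣q∣ λ x∈ → let x∈U , x∈reps = x∈p∩q⁻ _ _ x∈ in x∈p∩q⁺ (U⊆V x∈U , x∈reps)

  μ-strict : ∀ {U V x} → U ⊆ V → x ∈ V → x ∈ reps → x ∉ U → μ U < μ V
  μ-strict U⊆V x∈V x∈reps x∉U = p⊂q⇒∣p∣<∣q∣
    ( (λ y∈ → let y∈U , y∈reps = x∈p∩q⁻ _ _ y∈ in x∈p∩q⁺ (U⊆V y∈U , y∈reps))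
    , _ , x∈p∩q⁺ (x∈V , x∈reps) , λ x∈ → x∉U (proj₁ (x∈p∩q⁻ _ _ x∈)))

  -- For N[a] ∪ N[b] of maximal size, its part outside N[d] is a single twin
  -- class, so no N[d] ∪ N[t] can contain two twin classes outside N[d].
  module Extremal (a b : Fin n) (maximal : ∀ x y → μ (N[ G ] x ∪ N[ G ] y) ≤ μ (N[ G ] a ∪ N[ G ] b))
                  (d : Fin n) (twins : TwinsOn (_∈ (N[ G ] a ∪ N[ G ] b)) d) where

    S : Subset n
    S = N[ G ] a ∪ N[ G ] b

    μ≤ : ∀ t → μ (N[ G ] d ∪ N[ G ] t) ≤ μ S
    μ≤ t = maximal d t

    S-closed : ∀ {x} → rep x ∈ S → x ∈ S
    S-closed {x} rx∈ with x∈p∪q⁻ (N[ G ] a) _ rx∈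
    ... | inj₁ rx∈Na = x∈p∪q⁺ (inj₁ (N-≡ G (N-rep x) rx∈Na))
    ... | inj₂ rx∈Nb = x∈p∪q⁺ (inj₂ (N-≡ G (N-rep x) rx∈Nb))

    S⊆Nd∪Nr : ∀ {r} → r ∈ S → r ∉ N[ G ] d → S ⊆ N[ G ] d ∪ N[ G ] r
    S⊆Nd∪Nr {r} r∈S r∉ {s} s∈S with s ∈? N[ G ] d
    ... | yes s∈ = x∈p∪q⁺ (inj₁ s∈)
    ... | no  s∉ = x∈p∪q⁺ (inj₂ (twins r∈S s∈S r∈S r∉ s∉ (N-refl G r)))

    -- As `S ⊆ N[ G ] d ∪ N[ G ] r`, a neighbour of `r` outside `S` would make that union meet more
    -- twin classes than `S`, against maximality.
    Nr⊆S : ∀ {r} → r ∈ S → r ∉ N[ G ] d → N[ G ] r ⊆ S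
    Nr⊆S {r} r∈S r∉ {w} w∈ = S-closed (decidable-stable (rep w ∈? S) λ rw∉S →
      ℕ.<⇒≱ (μ-strict (S⊆Nd∪Nr r∈S r∉) (x∈p∪q⁺ (inj₂ (N-≡ G (sym (N-rep w)) w∈))) (rep-∈-reps w) rw∉S)
            (μ≤ r))

    -- Twins relative to `S` are twins in `G` here, because by `Nr⊆S` all their neighbours lie in
    -- `S`.
    rest-twins : ∀ {r s} → r ∈ S → s ∈ S → r ∉ N[ G ] d → s ∉ N[ G ] d → N[ G ] r ≡ N[ G ] s
    rest-twins r∈ s∈ r∉ s∉ = N-ext G
      (λ r∈Nt → twins r∈ s∈ (Nr⊆S r∈ r∉ (N-sym G r∈Nt)) r∉ s∉ r∈Nt)
      (λ s∈Nt → twins s∈ r∈ (Nr⊆S s∈ s∉ (N-sym G s∈Nt)) s∉ r∉ s∈Nt)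

    μS≤1+μNd : μ S ≤ suc (μ (N[ G ] d))
    μS≤1+μNd with any? (λ r → r ∈? (S ∩ ∁ (N[ G ] d)))
    ... | yes (r , r∈) = ℕ.≤-trans (p⊆q⇒∣p∣≤∣q∣ covered) (∣p∪⁅x⁆∣≤1+∣p∣ (N[ G ] d ∩ reps) (rep r))
      where
      r∈S×r∉ = x∈p∩q⁻ S _ r∈
      covered : S ∩ reps ⊆ (N[ G ] d ∩ reps) ∪ ⁅ rep r ⁆
      covered {s} s∈ with x∈p∩q⁻ S reps s∈
      ... | s∈S , s∈reps with s ∈? N[ G ] d
      ... | yes s∈Nd = x∈p∪q⁺ (inj₁ (x∈p∩q⁺ (s∈Nd , s∈reps)))
      ... | no  s∉Nd = x∈p∪q⁺ (inj₂ (subst (_∈ ⁅ rep r ⁆)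
        (trans (rep-≡ (rest-twins (proj₁ r∈S×r∉) s∈S (x∈∁p⇒x∉p (proj₂ r∈S×r∉)) s∉Nd)) (∈-reps⁻ s∈reps))
        (x∈⁅x⁆ (rep r))))
    ... | no none = ℕ.m≤n⇒m≤1+n (μ-mono λ {s} s∈S →
      decidable-stable (s ∈? N[ G ] d) λ s∉ → none (s , x∈p∩q⁺ (s∈S , x∉p⇒x∈∁p s∉)))

    separating : Separating G d
    separating {x} {y} {t} x∉ y∉ x∈Nt y∈Nt = decidable-stable (N[ G ] x ≟ˢ N[ G ] y) λ Nx≢Ny →
      -- Otherwise the classes of `x` and `y` would give `μ (N[ G ] d) + 2 ≤ μ U ≤ μ S ≤ μ (N[ G ]
      -- d) + 1`.
      ℕ.<⇒≱ (ℕ.≤-trans (s≤s Nd+1≤) (μ-strict Nd∪rx⊆ (∈U y∈Nt) (rep-∈-reps y) (ry∉ Nx≢Ny)))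
             (ℕ.≤-trans (μ≤ t) μS≤1+μNd)
      where
      U : Subset n
      U = N[ G ] d ∪ N[ G ] t
      ∈U : ∀ {w} → w ∈ N[ G ] t → rep w ∈ U
      ∈U {w} w∈ = x∈p∪q⁺ (inj₂ (N-≡ G (sym (N-rep w)) w∈))
      rep∉Nd : ∀ {w} → w ∉ N[ G ] d → rep w ∉ N[ G ] d
      rep∉Nd {w} w∉ rw∈ = w∉ (N-≡ G (N-rep w) rw∈)
      Nd∪rx⊆ : N[ G ] d ∪ ⁅ rep x ⁆ ⊆ U
      Nd∪rx⊆ w∈ with x∈p∪q⁻ (N[ G ] d) _ w∈
      ... | inj₁ w∈Nd = x∈p∪q⁺ (inj₁ w∈Nd)
      ... | inj₂ w∈rx = subst (_∈ U) (sym (x∈⁅y⁆⇒x≡y (rep x) w∈rx)) (∈U x∈Nt)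
      Nd+1≤ : μ (N[ G ] d) < μ (N[ G ] d ∪ ⁅ rep x ⁆)
      Nd+1≤ = μ-strict (x∈p∪q⁺ ∘ inj₁) (x∈p∪q⁺ (inj₂ (x∈⁅x⁆ (rep x)))) (rep-∈-reps x) (rep∉Nd x∉)
      ry∉ : N[ G ] x ≢ N[ G ] y → rep y ∉ N[ G ] d ∪ ⁅ rep x ⁆
      ry∉ Nx≢Ny ry∈ with x∈p∪q⁻ (N[ G ] d) _ ry∈
      ... | inj₁ ry∈Nd = rep∉Nd y∉ ry∈Nd
      ... | inj₂ ry∈rx = Nx≢Ny (rep≡⇒N≡ (sym (x∈⁅y⁆⇒x≡y (rep x) ry∈rx)))

  2-perfect⇒separating : 2-γg-Perfect G → ∃ (Separating G)
  2-perfect⇒separating perfect =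
    -- This vertex only ensures that there is a pair to maximize over.
    let v             = some-vertex G
        (a , b) , _ , maximal = maximum-∈ (λ e → μ (N[ G ] (proj₁ e) ∪ N[ G ] (proj₂ e)))
                                  (∈-cartesianProduct⁺ (∈-allFin v) (∈-allFin v))
        d , _ , twins = pair-twins perfect (_∈? (N[ G ] a ∪ N[ G ] b))
                          (x∈p∪q⁺ (inj₁ (N-refl G a))) (x∈p∪q⁺ (inj₂ (N-refl G b))) id
    in d , Extremal.separating a b
         (λ x y → maximal (∈-cartesianProduct⁺ (∈-allFin x) (∈-allFin y))) d twins

  -- The pair `b`, `d` dominates the path, yet each vertex of the path has two non-neighbours on it
  -- that are not twins within the path.
  no-P₅ : 2-γg-Perfect G → ∀ a b c d e →
          b ∈ N[ G ] a → c ∈ N[ G ] b → d ∈ N[ G ] c → e ∈ N[ G ] d →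
          c ∉ N[ G ] a → d ∉ N[ G ] a → e ∉ N[ G ] a → d ∉ N[ G ] b → e ∉ N[ G ] b → e ∉ N[ G ] c → ⊥
  no-P₅ perfect a b c d e ab bc cd de ac ad ae bd be ce =
    let v , v∈ , twins = pair-twins perfect (λ x → DecMembership._∈?_ _≟_ x path) b∈ d∈ dominated in absurd v∈ twins
    where
    path : List (Fin n)
    path = a ∷ b ∷ c ∷ d ∷ e ∷ []

    a∈ : a List.∈ path
    a∈ = here refl
    b∈ : b List.∈ path
    b∈ = there (here refl)
    c∈ : c List.∈ path
    c∈ = there (there (here refl))
    d∈ : d List.∈ path
    d∈ = there (there (there (here refl)))
    e∈ : e List.∈ path
    e∈ = there (there (there (there (here refl))))

    dominated : ∀ {x} → x List.∈ path → x ∈ N[ G ] b ∪ N[ G ] d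
    dominated (here refl)                                 = x∈p∪q⁺ (inj₁ (N-sym G ab))
    dominated (there (here refl))                         = x∈p∪q⁺ (inj₁ (N-refl G b))
    dominated (there (there (here refl)))                 = x∈p∪q⁺ (inj₁ bc)
    dominated (there (there (there (here refl))))         = x∈p∪q⁺ (inj₂ (N-refl G d))
    dominated (there (there (there (there (here refl))))) = x∈p∪q⁺ (inj₂ de)

    absurd : ∀ {v} → v List.∈ path → TwinsOn (List._∈ path) v → ⊥
    absurd (here refl)                                 twins = bd (twins c∈ d∈ b∈ ac ad bc)
    absurd (there (here refl))                         twins = ce (twins d∈ e∈ c∈ bd be cd)
    absurd (there (there (here refl)))                 twins = be (twins a∈ e∈ b∈ (ac ∘ N-sym G) ce (N-sym G ab))
    absurd (there (there (there (here refl))))         twins =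
      ac (N-sym G (twins b∈ a∈ c∈ (bd ∘ N-sym G) (ad ∘ N-sym G) (N-sym G bc)))
    absurd (there (there (there (there (here refl))))) twins =
      bd (N-sym G (twins c∈ b∈ d∈ (ce ∘ N-sym G) (be ∘ N-sym G) (N-sym G cd)))

-- The joining condition of a perfect set of cliques, for the twin classes outside `N[ G ] v`. If
-- `v` is separating, `a` and `b` are distinct, since a common closed neighbour would make `x` and
-- `y` twins.
Joined : Graph n → Fin n → Set
Joined G v = ∀ {x y a b} → x ∉ N[ G ] v → y ∉ N[ G ] v → N[ G ] x ≢ N[ G ] y →
             a ∈ N[ G ] x → a ∈ N[ G ] v → b ∈ N[ G ] y → b ∈ N[ G ] v → b ∈ N[ G ] a

-- If `a` and `b` were not adjacent, `x a v b y` would be an induced P₅.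
2-perfect⇒joined : (G : Graph n) → 2-γg-Perfect G → ∀ {v} → Separating G v → Joined G v
2-perfect⇒joined G perfect {v} separating {x} {y} {a} {b} x∉ y∉ Nx≢Ny a∈Nx a∈Nv b∈Ny b∈Nv =
  decidable-stable (b ∈? N[ G ] a) λ b∉Na →
    no-P₅ G perfect x a v b y a∈Nx (N-sym G a∈Nv) b∈Nv (N-sym G b∈Ny) (x∉ ∘ N-sym G)
      (λ b∈Nx → apart (N-sym G b∈Nx) (N-sym G b∈Ny)) (λ y∈Nx → apart (N-refl G x) y∈Nx)
      b∉Na (λ y∈Na → apart (N-sym G a∈Nx) y∈Na) y∉
  where
  apart : ∀ {t} → x ∈ N[ G ] t → y ∈ N[ G ] t → ⊥
  apart x∈Nt y∈Nt = Nx≢Ny (separating x∉ y∉ x∈Nt y∈Nt)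

-- Construction of 2-perfect graphs

T⇔T⇒≡ : ∀ {a b} → (T a → T b) → (T b → T a) → a ≡ b
T⇔T⇒≡ {false} {false} _ _ = refl
T⇔T⇒≡ {false} {true}  _ g = ⊥-elim (g _)
T⇔T⇒≡ {true}  {false} f _ = ⊥-elim (f _)
T⇔T⇒≡ {true}  {true}  _ _ = refl

∈⇒T-lookup : ∀ {p : Subset n} {x} → x ∈ p → T (Vec.lookup p x)
∈⇒T-lookup x∈p = Equivalence.from Bool.T-≡ (Vec.[]=⇒lookup x∈p)

T-lookup⇒∈ : ∀ {p : Subset n} {x} → T (Vec.lookup p x) → x ∈ p
T-lookup⇒∈ {p = p} {x} t = Vec.lookup⇒[]= x p (Equivalence.to Bool.T-≡ t)

∈-⋃⁺ : ∀ {Q : Subset n} {x 𝒬} → Q List.∈ 𝒬 → x ∈ Q → x ∈ ⋃ 𝒬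
∈-⋃⁺ (here refl) x∈Q = x∈p∪q⁺ (inj₁ x∈Q)
∈-⋃⁺ (there Q∈)  x∈Q = x∈p∪q⁺ (inj₂ (∈-⋃⁺ Q∈ x∈Q))

∈-⋃⁻ : ∀ {x : Fin n} 𝒬 → x ∈ ⋃ 𝒬 → ∃ λ Q → Q List.∈ 𝒬 × x ∈ Q
∈-⋃⁻ []      x∈ = contradiction x∈ ∉⊥
∈-⋃⁻ (Q ∷ 𝒬) x∈ with x∈p∪q⁻ Q _ x∈
... | inj₁ x∈Q = Q , here refl , x∈Q
... | inj₂ x∈⋃ = let Q′ , Q′∈ , x∈Q′ = ∈-⋃⁻ 𝒬 x∈⋃ in Q′ , there Q′∈ , x∈Q′

size-enumeration< : {P : Fin n → Set} (P? : ∀ x → Dec (P x)) {x : Fin n} → ¬ P x →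
                    Enumeration.size (enumeration P?) < n
size-enumeration< {n} P? {x} ¬px =
  subst (length (filter P? (allFin n)) <_) (List.length-tabulate {n = n} id)
    (List.filter-notAll P? (allFin n) (List.lose (∈-allFin x) ¬px))

≅-from-bijective : (F : Graph m) (G : Graph n) (f : Fin m → Fin n) →
                   (∀ {x y} → f x ≡ f y → x ≡ y) → (∀ y → ∃ λ x → f x ≡ y) →
                   (∀ u v → adj F u v ≡ adj G (f u) (f v)) → F ≅ G
≅-from-bijective F G f injective surjective preserves = record
  { bijection = ⤖⇒↔ (mk⤖ {to = f} (injective , λ y → proj₁ (surjective y) , λ { refl → proj₂ (surjective y) }))
  ; preserves = preserves
  }

-- When this fails, `N[ G ] x` consists of twins of `x` and is therefore a component that is a
-- complete graph.
Attached : Graph n → Fin n → Set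
Attached G x = ∃ λ a → a ∈ N[ G ] x × N[ G ] a ≢ N[ G ] x

-- Splitting off a complete component

module _ (G : Graph n) {x : Fin n} (unattached : ¬ Attached G x) where

  private
    twin : ∀ {y} → y ∈ N[ G ] x → N[ G ] y ≡ N[ G ] x
    twin {y} y∈ = decidable-stable (N[ G ] y ≟ˢ N[ G ] x) λ Ny≢Nx → unattached (y , y∈ , Ny≢Nx)

    outer? : ∀ y → Dec (y ∉ N[ G ] x)
    outer? y = ¬? (y ∈? N[ G ] x)

    module Out = Enumeration (enumeration outer?)
    module In  = Enumeration (enumeration (_∈? N[ G ] x))

    both : Fin Out.size ⊎ Fin In.size → Fin n
    both = [ Out.at , In.at ]′

    both-injective : ∀ {i j} → both i ≡ both j → i ≡ j
    both-injective {inj₁ i} {inj₁ j} eq = cong inj₁ (Out.at-injective eq)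
    both-injective {inj₁ i} {inj₂ j} eq = contradiction (subst (_∈ N[ G ] x) (sym eq) (In.at-∈ j)) (Out.at-∈ i)
    both-injective {inj₂ i} {inj₁ j} eq = contradiction (subst (_∈ N[ G ] x) eq (In.at-∈ i)) (Out.at-∈ j)
    both-injective {inj₂ i} {inj₂ j} eq = cong inj₂ (In.at-injective eq)

    splitAt-injective : ∀ m {n} {i j : Fin (m + n)} → splitAt m i ≡ splitAt m j → i ≡ j
    splitAt-injective m {n} {i} {j} eq =
      trans (sym (join-splitAt m n i)) (trans (cong (join m n) eq) (join-splitAt m n j))

    surjective : ∀ y → ∃ λ i → both (splitAt Out.size i) ≡ y
    surjective y with y ∈? N[ G ] x
    ... | yes y∈ = Out.size ↑ʳ In.index y∈ ,
                   trans (cong both (splitAt-↑ʳ Out.size In.size _)) (In.at-index y∈)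
    ... | no  y∉ = Out.index y∉ ↑ˡ In.size ,
                   trans (cong both (splitAt-↑ˡ Out.size _ In.size)) (Out.at-index y∉)

    non-adjacent : ∀ i j → adj G (Out.at i) (In.at j) ≡ false
    non-adjacent i j = T⇔T⇒≡
      (λ ij → contradiction (subst (Out.at i ∈_) (twin (In.at-∈ j)) (N-sym G (∈N⁺ G (inj₂ ij)))) (Out.at-∈ i))
      λ ()

    In-nonZero : NonZero In.size
    In-nonZero = inhabited⇒NonZero (In.index (N-refl G x))

    clique : ∀ i j → adj (K In.size {{In-nonZero}}) i j ≡ adj G (In.at i) (In.at j)
    clique i j with i ≟ j
    ... | yes refl = sym (adj-irr G (In.at i))
    ... | no  i≢j  = T⇔T⇒≡ (λ _ → adjacent (∈N⁻ G (subst (In.at j ∈_) (sym (twin (In.at-∈ i))) (In.at-∈ j)))) _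
      where
      adjacent : In.at i ≡ In.at j ⊎ Adj G (In.at i) (In.at j) → Adj G (In.at i) (In.at j)
      adjacent (inj₁ eq) = contradiction (In.at-injective eq) i≢j
      adjacent (inj₂ ij) = ij

  -- The vertex `v` outside the component `N[ G ] x` ensures that the remaining graph has a vertex.
  constructible-⊔ : {v : Fin n} → v ∉ N[ G ] x → 2-γg-Perfect G →
                    (∀ {m} (F : Graph m) → m < n → 2-γg-Perfect F → Constructible F) → Constructible G
  constructible-⊔ {v} v∉ perfect rec = relabel iso (add-K (rec F (size-enumeration< outer? λ x∉ → x∉ (N-refl G x))
      (2-γg-Perfect-⊑ F⊑G perfect)) In.size)
    where
    instance _ = In-nonZero

    F : Graph Out.size
    F = pullback G Out.at (inhabited⇒NonZero (Out.index v∉))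

    F⊑G : F ⊑ G
    F⊑G = record { embedding = mk↣ Out.at-injective ; preserves = λ _ _ → refl }

    preserves : ∀ i j → adj (F ⊔ᴳ K In.size) i j ≡ adj G (both (splitAt Out.size i)) (both (splitAt Out.size j))
    preserves i j with splitAt Out.size i | splitAt Out.size j
    ... | inj₁ i′ | inj₁ j′ = refl
    ... | inj₁ i′ | inj₂ j′ = sym (non-adjacent i′ j′)
    ... | inj₂ i′ | inj₁ j′ = sym (trans (adj-sym G _ _) (non-adjacent j′ i′))
    ... | inj₂ i′ | inj₂ j′ = clique i′ j′

    iso : (F ⊔ᴳ K In.size) ≅ G
    iso = ≅-from-bijective _ G (both ∘ splitAt Out.size)
            (splitAt-injective Out.size ∘ both-injective) surjective preserves

-- Deleting a separating vertex

module _ (G : Graph (suc (suc m))) {v : Fin (suc (suc m))} (separating : Separating G v) (joined : Joined G v)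
         (attached : ∀ {x} → x ∉ N[ G ] v → Attached G x) where

  private
    F : Graph (suc m)
    F = pullback G (punchIn v) _

    F⊑G : F ⊑ G
    F⊑G = record { embedding = mk↣ (punchIn-injective v _ _) ; preserves = λ _ _ → refl }

    N-F-≡ : ∀ {i j} → N[ G ] (punchIn v i) ≡ N[ G ] (punchIn v j) → N[ F ] i ≡ N[ F ] j
    N-F-≡ eq = N-ext F (N-ι⁻ F⊑G ∘ N-≡ G eq ∘ N-ι⁺ F⊑G) (N-ι⁻ F⊑G ∘ N-≡ G (sym eq) ∘ N-ι⁺ F⊑G)

    -- A twin class is indexed by its closed neighbourhood `p` rather than by a vertex, so that
    -- twins yield the same subset and distinct members of `𝒬` come from vertices that are not
    -- twins.
    Member : Subset (suc (suc m)) → Fin (suc m) → Set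
    Member p j = punchIn v j ∉ N[ G ] v × N[ G ] (punchIn v j) ≡ p

    member? : ∀ p j → Dec (Member p j)
    member? p j = ¬? (punchIn v j ∈? N[ G ] v) ×-dec (N[ G ] (punchIn v j) ≟ˢ p)

    class : Fin (suc m) → Subset (suc m)
    class i = ⟦ member? (N[ G ] (punchIn v i)) ⟧

    far? : ∀ i → Dec (punchIn v i ∉ N[ G ] v)
    far? i = ¬? (punchIn v i ∈? N[ G ] v)

    𝒬 : List (Subset (suc m))
    𝒬 = map class (filter far? (allFin (suc m)))

    ∈-class : ∀ {i j} → j ∈ class i → Member (N[ G ] (punchIn v i)) j
    ∈-class {i} = ∈⟦⟧⁻ (member? (N[ G ] (punchIn v i)))

    class-∋ : ∀ {i} → punchIn v i ∉ N[ G ] v → i ∈ class i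
    class-∋ {i} i∉ = ∈⟦⟧⁺ (member? (N[ G ] (punchIn v i))) (i∉ , refl)

    𝒬-∋ : ∀ {i} → punchIn v i ∉ N[ G ] v → class i List.∈ 𝒬
    𝒬-∋ {i} i∉ = ∈-map⁺ class (∈-filter⁺ far? (∈-allFin i) i∉)

    ∈-𝒬 : ∀ {Q} → Q List.∈ 𝒬 → ∃ λ i → punchIn v i ∉ N[ G ] v × Q ≡ class i
    ∈-𝒬 Q∈ = let i , i∈ , Q≡ = ∈-map⁻ class Q∈ in i , proj₂ (∈-filter⁻ far? {xs = allFin (suc m)} i∈) , Q≡

    class-≢ : ∀ {i j} → class i ≢ class j → N[ G ] (punchIn v i) ≢ N[ G ] (punchIn v j)
    class-≢ neq eq = neq (cong (λ p → ⟦ member? p ⟧) eq)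

    -- A closed neighbour of `x` that is not a twin of `x` lies in `N[ G ] v`, since `v` is
    -- separating; it differs from `v` because `x` is not adjacent to `v`.
    neighbour : ∀ {x} → x ∉ N[ G ] v → ∃ λ a → punchIn v a ∈ N[ G ] x × punchIn v a ∈ N[ G ] v
    neighbour {x} x∉ with attached x∉
    ... | a , a∈Nx , Na≢Nx = punchOut v≢a , subst (_∈ N[ G ] x) (sym pa≡a) a∈Nx , subst (_∈ N[ G ] v) (sym pa≡a) a∈Nv
      where
      v≢a : v ≢ a
      v≢a refl = x∉ (N-sym G a∈Nx)
      pa≡a : punchIn v (punchOut v≢a) ≡ a
      pa≡a = punchIn-punchOut v≢a
      a∈Nv : a ∈ N[ G ] v
      a∈Nv = decidable-stable (a ∈? N[ G ] v) λ a∉ → Na≢Nx (sym (separating x∉ a∉ (N-refl G x) a∈Nx))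

    ≢∧N⇒Adj : ∀ {i j} → i ≢ j → j ∈ N[ F ] i → Adj F i j
    ≢∧N⇒Adj i≢j j∈ with ∈N⁻ F j∈
    ... | inj₁ i≡j = contradiction i≡j i≢j
    ... | inj₂ ij  = ij

    homogeneousClique : ∀ {i} → punchIn v i ∉ N[ G ] v → HomogeneousClique F (class i)
    homogeneousClique {i} i∉ = record
      { nonempty    = i , class-∋ i∉
      ; clique      = λ u∈ w∈ u≢w → ≢∧N⇒Adj u≢w (subst (_ ∈_) (homogeneous w∈ u∈) (N-refl F _))
      ; homogeneous = homogeneous
      }
      where
      homogeneous : ∀ {u w} → u ∈ class i → w ∈ class i → N[ F ] u ≡ N[ F ] w
      homogeneous u∈ w∈ = N-F-≡ (trans (proj₂ (∈-class u∈)) (sym (proj₂ (∈-class w∈))))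

    module _ {i j} (i∉ : punchIn v i ∉ N[ G ] v) (j∉ : punchIn v j ∉ N[ G ] v) (neq : class i ≢ class j) where

      apart : ∀ {x y t} → x ∈ class i → y ∈ class j → x ∈ N[ F ] t → y ∈ N[ F ] t → ⊥
      apart x∈ y∈ x∈Nt y∈Nt with ∈-class x∈ | ∈-class y∈
      ... | x∉ , Nx≡ | y∉ , Ny≡ = class-≢ neq
        (trans (sym Nx≡) (trans (separating x∉ y∉ (N-ι⁺ F⊑G x∈Nt) (N-ι⁺ F⊑G y∈Nt)) Ny≡))

      linked : ∀ {x y a b} → x ∈ class i → y ∈ class j → a ∈ N[ F ] x → punchIn v a ∈ N[ G ] v →
               b ∈ N[ F ] y → punchIn v b ∈ N[ G ] v → Adj F a b
      linked {x} {y} {a} {b} x∈ y∈ a∈Nx a∈Nv b∈Ny b∈Nv = ≢∧N⇒Adj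
        (λ { refl → apart x∈ y∈ (N-sym F a∈Nx) (N-sym F b∈Ny) })
        (N-ι⁻ F⊑G (joined (proj₁ (∈-class x∈)) (proj₁ (∈-class y∈))
          (λ Nx≡Ny → class-≢ neq (trans (sym (proj₂ (∈-class x∈))) (trans Nx≡Ny (proj₂ (∈-class y∈)))))
          (N-ι⁺ F⊑G a∈Nx) a∈Nv (N-ι⁺ F⊑G b∈Ny) b∈Nv))

      -- A walk of length at most two has a vertex whose closed neighbourhood contains both ends,
      -- which `apart` forbids.
      3≤walk : ∀ {x y k} → x ∈ class i → y ∈ class j → Walk F x y k → 3 ≤ k
      3≤walk x∈ y∈ []                 = ⊥-elim (apart x∈ y∈ (N-refl F _) (N-refl F _))
      3≤walk x∈ y∈ (xy ∷ [])          = ⊥-elim (apart x∈ y∈ (N-refl F _) (∈N⁺ F (inj₂ xy)))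
      3≤walk x∈ y∈ (xt ∷ ty ∷ [])     =
        ⊥-elim (apart x∈ y∈ (N-sym F (∈N⁺ F (inj₂ xt))) (∈N⁺ F (inj₂ ty)))
      3≤walk x∈ y∈ (_ ∷ _ ∷ _ ∷ walk) = s≤s (s≤s (s≤s z≤n))

      distance-3 : SetDistance F (class i) (class j) 3
      distance-3 with neighbour i∉ | neighbour j∉
      ... | a , a∈Ni , a∈Nv | b , b∈Nj , b∈Nv =
        (i , j , class-∋ i∉ , class-∋ j∉ , walk , λ _ → 3≤walk (class-∋ i∉) (class-∋ j∉)) ,
        λ _ (_ , _ , x∈ , y∈ , distance) → 3≤walk x∈ y∈ (proj₁ distance)
        where
        -- The walk is `i`, `a`, `b`, `j`; its inner vertices lie in `N[ G ] v` and are adjacent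
        -- because `v` is joined.
        walk : Walk F i j 3
        walk = ≢∧N⇒Adj (λ { refl → i∉ a∈Nv }) (N-ι⁻ F⊑G a∈Ni)
             ∷ linked (class-∋ i∉) (class-∋ j∉) (N-ι⁻ F⊑G a∈Ni) a∈Nv (N-ι⁻ F⊑G b∈Nj) b∈Nv
             ∷ ≢∧N⇒Adj (λ { refl → j∉ b∈Nv }) (N-sym F (N-ι⁻ F⊑G b∈Nj))
             ∷ []

    -- A closed neighbour of the class outside `N[ G ] v` would be a twin, hence a member of the
    -- class.
    N′⇒near : ∀ {i a} → N′ F (class i) a → ∃ λ x → x ∈ class i × a ∈ N[ F ] x × punchIn v a ∈ N[ G ] v
    N′⇒near {i} {a} ((x , x∈ , a∈Nx) , a∉) = x , x∈ , a∈Nx ,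
      decidable-stable (punchIn v a ∈? N[ G ] v) λ a∉Nv →
        a∉ (∈⟦⟧⁺ (member? (N[ G ] (punchIn v i))) (a∉Nv ,
          trans (separating a∉Nv (proj₁ (∈-class x∈)) (N-ι⁺ F⊑G a∈Nx) (N-refl G _)) (proj₂ (∈-class x∈))))

    perfectSet : PerfectSetOfCliques F 𝒬
    perfectSet = record { cliques = cliques ; distance-3 = distance ; joined = join′ }
      where
      cliques : ∀ {Q} → Q List.∈ 𝒬 → HomogeneousClique F Q
      cliques Q∈ with ∈-𝒬 Q∈
      ... | i , i∉ , refl = homogeneousClique i∉

      distance : ∀ {Q Q′} → Q List.∈ 𝒬 → Q′ List.∈ 𝒬 → Q ≢ Q′ → SetDistance F Q Q′ 3
      distance Q∈ Q′∈ neq with ∈-𝒬 Q∈ | ∈-𝒬 Q′∈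
      ... | i , i∉ , refl | j , j∉ , refl = distance-3 i∉ j∉ neq

      join′ : ∀ {Q Q′} → Q List.∈ 𝒬 → Q′ List.∈ 𝒬 → Q ≢ Q′ → ∀ {x x′} → N′ F Q x → N′ F Q′ x′ → Adj F x x′
      join′ Q∈ Q′∈ neq x∈ x′∈ with ∈-𝒬 Q∈ | ∈-𝒬 Q′∈
      ... | i , i∉ , refl | j , j∉ , refl with N′⇒near x∈ | N′⇒near x′∈
      ... | y , y∈ , x∈Ny , x∈Nv | y′ , y′∈ , x′∈Ny′ , x′∈Nv = linked i∉ j∉ neq y∈ y′∈ x∈Ny x∈Nv x′∈Ny′ x′∈Nv

    -- The members of `𝒬` cover exactly the vertices outside `N[ G ] v`, so the new vertex of
    -- `𝒪 F 𝒬` plays the role of `v`.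
    new-adj : ∀ i → Vec.lookup (∁ (⋃ 𝒬)) i ≡ adj G v (punchIn v i)
    new-adj i = T⇔T⇒≡ near⇒adj λ vi → ∈⇒T-lookup (x∉p⇒x∈∁p (far vi))
      where
      near⇒adj : T (Vec.lookup (∁ (⋃ 𝒬)) i) → Adj G v (punchIn v i)
      near⇒adj t with ∈N⁻ G (decidable-stable (punchIn v i ∈? N[ G ] v) λ i∉ →
                        x∈∁p⇒x∉p (T-lookup⇒∈ t) (∈-⋃⁺ (𝒬-∋ i∉) (class-∋ i∉)))
      ... | inj₁ v≡pi = contradiction (sym v≡pi) (punchInᵢ≢i v i)
      ... | inj₂ vi   = vi
      far : Adj G v (punchIn v i) → i ∉ ⋃ 𝒬
      far vi i∈ with ∈-⋃⁻ 𝒬 i∈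
      ... | Q , Q∈ , i∈Q with ∈-𝒬 Q∈
      ... | j , j∉ , refl = proj₁ (∈-class i∈Q) (∈N⁺ G (inj₂ vi))

    iso : 𝒪 F 𝒬 ≅ G
    iso = ≅-from-bijective (𝒪 F 𝒬) G f injective surjective preserves
      where
      f : Fin (suc (suc m)) → Fin (suc (suc m))
      f zero    = v
      f (suc i) = punchIn v i
      injective : ∀ {x y} → f x ≡ f y → x ≡ y
      injective {zero}  {zero}  _  = refl
      injective {zero}  {suc j} eq = contradiction (sym eq) (punchInᵢ≢i v j)
      injective {suc i} {zero}  eq = contradiction eq (punchInᵢ≢i v i)
      injective {suc i} {suc j} eq = cong suc (punchIn-injective v i j eq)
      surjective : ∀ y → ∃ λ x → f x ≡ y
      surjective y with v ≟ y
      ... | yes v≡y = zero , v≡y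
      ... | no  v≢y = suc (punchOut v≢y) , punchIn-punchOut v≢y
      preserves : ∀ u w → adj (𝒪 F 𝒬) u w ≡ adj G (f u) (f w)
      preserves zero    zero    = sym (adj-irr G v)
      preserves zero    (suc j) = new-adj j
      preserves (suc i) zero    = trans (new-adj i) (adj-sym G v _)
      preserves (suc i) (suc j) = refl

  constructible-𝒪 : 2-γg-Perfect G →
                    (∀ {k} (F : Graph k) → k < suc (suc m) → 2-γg-Perfect F → Constructible F) → Constructible G
  constructible-𝒪 perfect rec =
    relabel iso (add-𝒪 (rec F ℕ.≤-refl (2-γg-Perfect-⊑ F⊑G perfect)) 𝒬 perfectSet)

-- Induction on the number of vertices: if some vertex outside `N[ G ] v` is unattached, its
-- component is complete and is split off; otherwise `v` is deleted.
2-perfect⇒constructible : (G : Graph n) → 2-γg-Perfect G → Constructible G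
2-perfect⇒constructible {n} G = go n G ℕ.≤-refl
  where
  go : ∀ b {n} (G : Graph n) → n ≤ b → 2-γg-Perfect G → Constructible G
  go b {zero} G _ _ = contradiction (nonEmpty G) λ ()
  go b {suc zero} G _ _ = relabel
    (≅-from-bijective (K 1) G id id (λ y → y , refl) λ { zero zero → sym (adj-irr G zero) }) K₁
  go (suc b) {suc (suc m)} G (s≤s n≤b) perfect =
    let v , separating = 2-perfect⇒separating G perfect in step v separating (any? (unattached? v))
    where
    attached? : ∀ x → Dec (Attached G x)
    attached? x = any? λ a → (a ∈? N[ G ] x) ×-dec ¬? (N[ G ] a ≟ˢ N[ G ] x)

    unattached? : ∀ v x → Dec (x ∉ N[ G ] v × ¬ Attached G x)
    unattached? v x = ¬? (x ∈? N[ G ] v) ×-dec ¬? (attached? x)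

    rec : ∀ {k} (F : Graph k) → k < suc (suc m) → 2-γg-Perfect F → Constructible F
    rec F k<n = go b F (ℕ.≤-trans (s≤s⁻¹ k<n) n≤b)

    step : ∀ v → Separating G v → Dec (∃ λ x → x ∉ N[ G ] v × ¬ Attached G x) → Constructible G
    step v separating (yes (x , x∉ , unattached)) = constructible-⊔ G unattached (x∉ ∘ N-sym G) perfect rec
    step v separating (no attached) = constructible-𝒪 G separating (2-perfect⇒joined G perfect separating)
      (λ {x} x∉ → decidable-stable (attached? x) λ unattached → attached (x , x∉ , unattached)) perfect rec

-- Induced subgraphs of constructible graphs

module _ (G : Graph n) (S : Fin n → Set) (v : Fin n) where

  -- The condition `Separating` for the subgraph induced on `S`, with one inclusion of
  -- neighbourhoods in place of equality; exchanging `x` and `y` gives the other.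
  SeparatingOn : Set
  SeparatingOn = ∀ {x y t w} → S x → S y → S t → S w → x ∉ N[ G ] v → y ∉ N[ G ] v →
                 x ∈ N[ G ] t → y ∈ N[ G ] t → x ∈ N[ G ] w → y ∈ N[ G ] w

  -- The vertex w witnesses that x and y are not twins.
  JoinedOn : Set
  JoinedOn = ∀ {x y a b w} → S x → S y → S a → S b → S w → x ∉ N[ G ] v → y ∉ N[ G ] v →
             x ∈ N[ G ] w → y ∉ N[ G ] w → a ∈ N[ G ] x → a ∈ N[ G ] v → b ∈ N[ G ] y → b ∈ N[ G ] v →
             b ∈ N[ G ] a

  GoodOn : Set
  GoodOn = S v × SeparatingOn × JoinedOn

-- Induced subgraphs are represented by their vertex sets `S`, so that they are all handled inside
-- `G` without renaming vertices.
HereditarilyGood : Graph n → Set₁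
HereditarilyGood {n} G = (S : Fin n → Set) → (∀ x → Dec (S x)) → ∃ S → ∃ (GoodOn G S)

-- Within `S` the image of `F` is a union of components and the rest is a clique. Two vertices with
-- a common neighbour in the rest are thus twins, and every other configuration lies entirely in the
-- image.
GoodOn-⊑ : {F : Graph m} {G : Graph n} (F⊑G : F ⊑ G) {S : Fin n → Set} →
           let Image = λ x → ∃ λ i → ι F⊑G i ≡ x in
           (∀ {x t} → S x → S t → x ∈ N[ G ] t → Image t → Image x) →
           (∀ {x y} → S x → S y → ¬ Image x → ¬ Image y → x ∈ N[ G ] y) →
           ∀ {v} → GoodOn F (S ∘ ι F⊑G) v → GoodOn G S (ι F⊑G v)
GoodOn-⊑ {F = F} {G} F⊑G {S} closed complete {v} (v∈ , separating , joined) = v∈ , separating′ , joined′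
  where
  Image : _ → Set
  Image x = ∃ λ i → ι F⊑G i ≡ x

  image? : ∀ x → Dec (Image x)
  image? x = any? λ i → ι F⊑G i ≟ x

  separating′ : SeparatingOn G S (ι F⊑G v)
  separating′ {x} {y} {t} {w} x∈ y∈ t∈ w∈ x∉ y∉ x∈Nt y∈Nt x∈Nw with image? t
  ... | no t∉im = complete y∈ w∈ (λ y∈im → t∉im (closed t∈ y∈ (N-sym G y∈Nt) y∈im))
                    (λ w∈im → t∉im (closed t∈ x∈ (N-sym G x∈Nt) (closed x∈ w∈ x∈Nw w∈im)))
  ... | yes t∈im with closed x∈ t∈ x∈Nt t∈im | closed y∈ t∈ y∈Nt t∈im
  ... | x∈im | y∈im with closed w∈ x∈ (N-sym G x∈Nw) x∈im
  ... | w∈im with t∈im | x∈im | y∈im | w∈im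
  ... | t , refl | x , refl | y , refl | w , refl =
    N-ι⁺ F⊑G (separating x∈ y∈ t∈ w∈ (x∉ ∘ N-ι⁺ F⊑G) (y∉ ∘ N-ι⁺ F⊑G) (N-ι⁻ F⊑G x∈Nt) (N-ι⁻ F⊑G y∈Nt)
      (N-ι⁻ F⊑G x∈Nw))

  joined′ : JoinedOn G S (ι F⊑G v)
  joined′ x∈ y∈ a∈ b∈ w∈ x∉ y∉ x∈Nw y∉Nw a∈Nx a∈Nv b∈Ny b∈Nv
    with closed a∈ v∈ a∈Nv (v , refl) | closed b∈ v∈ b∈Nv (v , refl)
  ... | a∈im | b∈im with closed x∈ a∈ (N-sym G a∈Nx) a∈im | closed y∈ b∈ (N-sym G b∈Ny) b∈im
  ... | x∈im | y∈im with closed w∈ x∈ (N-sym G x∈Nw) x∈im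
  ... | w∈im with a∈im | b∈im | x∈im | y∈im | w∈im
  ... | a , refl | b , refl | x , refl | y , refl | w , refl =
    N-ι⁺ F⊑G (joined x∈ y∈ a∈ b∈ w∈ (x∉ ∘ N-ι⁺ F⊑G) (y∉ ∘ N-ι⁺ F⊑G) (N-ι⁻ F⊑G x∈Nw) (y∉Nw ∘ N-ι⁺ F⊑G)
      (N-ι⁻ F⊑G a∈Nx) (N-ι⁻ F⊑G a∈Nv) (N-ι⁻ F⊑G b∈Ny) (N-ι⁻ F⊑G b∈Nv))

GoodOn-⊑-image : {F : Graph m} {G : Graph n} (F⊑G : F ⊑ G) {S : Fin n → Set} →
                 (∀ {x} → S x → ∃ λ i → ι F⊑G i ≡ x) → ∀ {v} → GoodOn F (S ∘ ι F⊑G) v → GoodOn G S (ι F⊑G v)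
GoodOn-⊑-image F⊑G image =
  GoodOn-⊑ F⊑G (λ x∈ _ _ _ → image x∈) (λ x∈ _ x∉im _ → contradiction (image x∈) x∉im)

≅⇒⊑ : {F : Graph m} {G : Graph n} → F ≅ G → F ⊑ G
≅⇒⊑ F≅G = record
  { embedding = mk↣ λ eq → trans (sym (Inverse.strictlyInverseʳ bijection _))
                  (trans (cong (Inverse.from bijection) eq) (Inverse.strictlyInverseʳ bijection _))
  ; preserves = preserves
  }
  where open _≅_ F≅G

hereditarilyGood-≅ : {F : Graph m} {G : Graph n} → F ≅ G → HereditarilyGood F → HereditarilyGood G
hereditarilyGood-≅ {G = G} F≅G good S S? (s , s∈) =
  let v , v-good = good (S ∘ f) (S? ∘ f) (f⁻¹ s , subst S (sym (f∘f⁻¹ s)) s∈)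
  in f v , GoodOn-⊑-image (≅⇒⊑ F≅G) (λ {x} _ → f⁻¹ x , f∘f⁻¹ x) v-good
  where
  open _≅_ F≅G
  open Inverse bijection renaming (to to f; from to f⁻¹; strictlyInverseˡ to f∘f⁻¹)

-- Disjoint union with a complete graph

module _ (F : Graph m) (s : ℕ) {{_ : NonZero s}} where

  private
    H : Graph (m + s)
    H = F ⊔ᴳ K s

    preserves : ∀ i j → adj F i j ≡ adj H (i ↑ˡ s) (j ↑ˡ s)
    preserves i j rewrite splitAt-↑ˡ m i s | splitAt-↑ˡ m j s = refl

    F⊑H : F ⊑ H
    F⊑H = record { embedding = mk↣ (↑ˡ-injective s _ _) ; preserves = preserves }

    Left : Fin (m + s) → Set
    Left x = ∃ λ i → i ↑ˡ s ≡ x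

    adj-↑ʳ : ∀ i j → adj H (m ↑ʳ i) (m ↑ʳ j) ≡ adj (K s) i j
    adj-↑ʳ i j rewrite splitAt-↑ʳ m s i | splitAt-↑ʳ m s j = refl

    adj-↑ˡ↑ʳ : ∀ i j → adj H (i ↑ˡ s) (m ↑ʳ j) ≡ false
    adj-↑ˡ↑ʳ i j rewrite splitAt-↑ˡ m i s | splitAt-↑ʳ m s j = refl

    side : ∀ x → Left x ⊎ ∃ λ j → m ↑ʳ j ≡ x
    side x with splitAt m x in eq
    ... | inj₁ i = inj₁ (i , splitAt⁻¹-↑ˡ eq)
    ... | inj₂ j = inj₂ (j , splitAt⁻¹-↑ʳ eq)

    closed : ∀ {x t} → x ∈ N[ H ] t → Left t → Left x
    closed {x} x∈Nt (i , refl) with ∈N⁻ H x∈Nt | side x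
    ... | inj₁ refl | _               = i , refl
    ... | inj₂ tx   | inj₁ left       = left
    ... | inj₂ tx   | inj₂ (j , refl) = ⊥-elim (subst T (adj-↑ˡ↑ʳ i j) tx)

    complete : ∀ {x y} → ¬ Left x → ¬ Left y → x ∈ N[ H ] y
    complete {x} {y} x∉ y∉ with side x | side y
    ... | inj₁ left       | _               = contradiction left x∉
    ... | _               | inj₁ left       = contradiction left y∉
    ... | inj₂ (i , refl) | inj₂ (j , refl) with j ≟ i
    ... | yes refl = N-refl H _
    ... | no  j≢i  = ∈N⁺ H (inj₂ (subst T (sym (adj-↑ʳ j i)) (K-adj j≢i)))
      where
      K-adj : ∀ {i j} → i ≢ j → Adj (K s) i j
      K-adj {i} {j} i≢j with i ≟ j
      ... | yes i≡j = contradiction i≡j i≢j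
      ... | no  _   = _

  hereditarilyGood-⊔ : HereditarilyGood F → HereditarilyGood H
  hereditarilyGood-⊔ good S S? (x , x∈) with any? (λ i → S? (i ↑ˡ s))
  ... | yes nonempty = let v , v-good = good (S ∘ (_↑ˡ s)) (S? ∘ (_↑ˡ s)) nonempty in
    v ↑ˡ s , GoodOn-⊑ F⊑H (λ _ _ → closed) (λ _ _ → complete) v-good
  -- Now `S` lies in the complete part, where `x` has no non-neighbours, so both conditions are
  -- vacuous.
  ... | no  empty = x , x∈ ,
    (λ y∈ _ _ _ y∉ → contradiction (complete (right y∈) (right x∈)) y∉) ,
    (λ y∈ _ _ _ _ y∉ → contradiction (complete (right y∈) (right x∈)) y∉)
    where
    right : ∀ {y} → S y → ¬ Left y
    right y∈ (i , refl) = empty (i , y∈)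

-- `SetDistance` minimizes over exact distances, so contradicting distance 3 takes a shortest walk
-- and not merely a short one.
close : (G : Graph n) → ∀ {x y t} → x ∈ N[ G ] t → y ∈ N[ G ] t → ∃ λ k → k ≤ 2 × Distance G x y k
close G {x} {y} x∈Nt y∈Nt with y ∈? N[ G ] x
... | yes y∈Nx with ∈N⁻ G y∈Nx | x ≟ y
...   | _         | yes refl = 0 , z≤n , [] , λ _ _ → z≤n
...   | inj₁ x≡y  | no x≢y   = contradiction x≡y x≢y
...   | inj₂ xy   | no x≢y   = 1 , s≤s z≤n , xy ∷ [] , λ { _ [] → contradiction refl x≢y ; _ (_ ∷ _) → s≤s z≤n }
close G {x} {y} x∈Nt y∈Nt | no y∉Nx with ∈N⁻ G x∈Nt | ∈N⁻ G y∈Nt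
... | inj₁ refl | _         = contradiction y∈Nt y∉Nx
... | inj₂ _    | inj₁ refl = contradiction (N-sym G x∈Nt) y∉Nx
... | inj₂ tx   | inj₂ ty   = 2 , ℕ.≤-refl , Adj-sym G tx ∷ ty ∷ [] , λ where
  _ []          → contradiction (N-refl G _) y∉Nx
  _ (xy ∷ [])   → contradiction (∈N⁺ G (inj₂ xy)) y∉Nx
  _ (_ ∷ _ ∷ _) → s≤s (s≤s z≤n)

-- Adding a vertex along a perfect set of cliques

module _ (F : Graph n) (𝒬 : List (Subset n)) (perfectSet : PerfectSetOfCliques F 𝒬) where
  open PerfectSetOfCliques perfectSet

  private
    H : Graph (suc n)
    H = 𝒪 F 𝒬

    F⊑H : F ⊑ H
    F⊑H = record { embedding = mk↣ suc-injective ; preserves = λ _ _ → refl }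

    far⇒∈𝒬 : ∀ {i} → suc i ∉ N[ H ] zero → ∃ λ Q → Q List.∈ 𝒬 × i ∈ Q
    far⇒∈𝒬 {i} i∉ = ∈-⋃⁻ 𝒬 (decidable-stable (i ∈? ⋃ 𝒬) λ i∉⋃ →
      i∉ (∈N⁺ H {zero} (inj₂ (∈⇒T-lookup (x∉p⇒x∈∁p i∉⋃)))))

    near⇒∉𝒬 : ∀ {i Q} → suc i ∈ N[ H ] zero → Q List.∈ 𝒬 → i ∉ Q
    near⇒∉𝒬 i∈ Q∈ i∈Q with ∈N⁻ H {zero} i∈
    ... | inj₂ 0i = x∈∁p⇒x∉p (T-lookup⇒∈ 0i) (∈-⋃⁺ Q∈ i∈Q)

    -- Members of one clique are twins in `F`, and the closed neighbourhood of the new vertex does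
    -- not contain `i`.
    twins : ∀ {i j w Q} → Q List.∈ 𝒬 → i ∈ Q → j ∈ Q → suc i ∉ N[ H ] zero → suc i ∈ N[ H ] w → suc j ∈ N[ H ] w
    twins {w = zero}  Q∈ i∈ j∈ i∉ i∈N0 = contradiction i∈N0 i∉
    twins {w = suc w} Q∈ i∈ j∈ i∉ i∈Nw = N-ι⁺ F⊑H (N-≡ F (HomogeneousClique.homogeneous (cliques Q∈) i∈ j∈) (N-ι⁻ F⊑H i∈Nw))

    apart : ∀ {i j t Q Q′} → Q List.∈ 𝒬 → Q′ List.∈ 𝒬 → Q ≢ Q′ → i ∈ Q → j ∈ Q′ →
            i ∈ N[ F ] t → j ∈ N[ F ] t → ⊥
    apart Q∈ Q′∈ neq i∈ j∈ i∈Nt j∈Nt =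
      let k , k≤2 , distance = close F i∈Nt j∈Nt
      in ℕ.<⇒≱ (proj₂ (distance-3 Q∈ Q′∈ neq) k (_ , _ , i∈ , j∈ , distance)) k≤2

    -- The non-neighbours of the new vertex form the cliques. Two of them with a common closed
    -- neighbour lie in the same clique, as distinct cliques are at distance 3.
    separating : ∀ {S} → SeparatingOn H S zero
    separating {x = zero}  _ _ _ _ x∉ = contradiction (N-refl H zero) x∉
    separating {y = zero}  _ _ _ _ _ y∉ = contradiction (N-refl H zero) y∉
    separating {t = zero}  _ _ _ _ x∉ _ x∈N0 = contradiction x∈N0 x∉
    separating {x = suc i} {suc j} {suc t} {w} _ _ _ _ x∉ y∉ x∈Nt y∈Nt with far⇒∈𝒬 x∉ | far⇒∈𝒬 y∉
    ... | Q , Q∈ , i∈ | Q′ , Q′∈ , j∈ with Q ≟ˢ Q′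
    ... | yes refl = twins Q∈ i∈ j∈ x∉
    ... | no  neq  = ⊥-elim (apart Q∈ Q′∈ neq i∈ j∈ (N-ι⁻ F⊑H x∈Nt) (N-ι⁻ F⊑H y∈Nt))

    -- The vertex `w` forces `x` and `y` into distinct cliques, while `a` and `b`, being adjacent to
    -- the new vertex, lie in no clique and hence in the respective `N′`.
    joined′ : ∀ {S} → JoinedOn H S zero
    joined′ {x = zero}  _ _ _ _ _ x∉ = contradiction (N-refl H zero) x∉
    joined′ {y = zero}  _ _ _ _ _ _ y∉ = contradiction (N-refl H zero) y∉
    joined′ {a = zero}  _ _ _ _ _ x∉ _ _ _ a∈Nx = contradiction (N-sym H a∈Nx) x∉
    joined′ {b = zero}  _ _ _ _ _ _ y∉ _ _ _ _ b∈Ny = contradiction (N-sym H b∈Ny) y∉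
    joined′ {x = suc i} {suc j} {suc a} {suc b} _ _ _ _ _ x∉ y∉ x∈Nw y∉Nw a∈Nx a∈N0 b∈Ny b∈N0
      with far⇒∈𝒬 x∉ | far⇒∈𝒬 y∉
    ... | Q , Q∈ , i∈ | Q′ , Q′∈ , j∈ = N-ι⁺ F⊑H (∈N⁺ F (inj₂ (joined Q∈ Q′∈
        (λ { refl → y∉Nw (twins Q∈ i∈ j∈ x∉ x∈Nw) })
        ((i , i∈ , N-ι⁻ F⊑H a∈Nx) , near⇒∉𝒬 a∈N0 Q∈)
        ((j , j∈ , N-ι⁻ F⊑H b∈Ny) , near⇒∉𝒬 b∈N0 Q′∈))))

  hereditarilyGood-𝒪 : HereditarilyGood F → HereditarilyGood H
  hereditarilyGood-𝒪 good S S? nonempty with S? zero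
  ... | yes 0∈ = zero , 0∈ , separating {S} , joined′ {S}
  ... | no  0∉ = let v , v-good = good (S ∘ suc) (S? ∘ suc) (nonempty′ nonempty)
                 in suc v , GoodOn-⊑-image F⊑H image v-good
    where
    nonempty′ : ∃ S → ∃ (S ∘ suc)
    nonempty′ (zero  , 0∈) = contradiction 0∈ 0∉
    nonempty′ (suc i , i∈) = i , i∈
    image : ∀ {x} → S x → ∃ λ i → suc i ≡ x
    image {zero}  0∈ = contradiction 0∈ 0∉
    image {suc i} _  = i , refl

constructible⇒hereditarilyGood : {G : Graph n} → Constructible G → HereditarilyGood G
constructible⇒hereditarilyGood K₁ S S? (zero , 0∈) = zero , 0∈ ,
  (λ { {x = zero} _ _ _ _ x∉ → contradiction (N-refl (K 1) zero) x∉ }) ,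
  (λ { {x = zero} _ _ _ _ _ x∉ → contradiction (N-refl (K 1) zero) x∉ })
constructible⇒hereditarilyGood (add-K {F = F} c s)    = hereditarilyGood-⊔ F s (constructible⇒hereditarilyGood c)
constructible⇒hereditarilyGood (add-𝒪 {F = F} c 𝒬 p)  = hereditarilyGood-𝒪 F 𝒬 p (constructible⇒hereditarilyGood c)
constructible⇒hereditarilyGood (relabel F≅G c)        = hereditarilyGood-≅ F≅G (constructible⇒hereditarilyGood c)

hereditarilyGood-⊑ : {F : Graph m} {G : Graph n} → F ⊑ G → HereditarilyGood G → HereditarilyGood F
hereditarilyGood-⊑ {F = F} {G} F⊑G good S S? (s , s∈) = go (good S′ S′? (ι F⊑G s , s , s∈ , refl))
  where
  S′ : _ → Set
  S′ y = ∃ λ x → S x × ι F⊑G x ≡ y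

  S′? : ∀ y → Dec (S′ y)
  S′? y = any? λ x → S? x ×-dec (ι F⊑G x ≟ y)

  go : ∃ (GoodOn G S′) → ∃ (GoodOn F S)
  go (_ , (v , v∈ , refl) , separating , joined) = v , v∈ ,
    (λ x∈ y∈ t∈ w∈ x∉ y∉ x∈Nt y∈Nt x∈Nw → N-ι⁻ F⊑G
      (separating (im x∈) (im y∈) (im t∈) (im w∈) (x∉ ∘ N-ι⁻ F⊑G) (y∉ ∘ N-ι⁻ F⊑G)
        (N-ι⁺ F⊑G x∈Nt) (N-ι⁺ F⊑G y∈Nt) (N-ι⁺ F⊑G x∈Nw))) ,
    (λ x∈ y∈ a∈ b∈ w∈ x∉ y∉ x∈Nw y∉Nw a∈Nx a∈Nv b∈Ny b∈Nv → N-ι⁻ F⊑G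
      (joined (im x∈) (im y∈) (im a∈) (im b∈) (im w∈) (x∉ ∘ N-ι⁻ F⊑G) (y∉ ∘ N-ι⁻ F⊑G)
        (N-ι⁺ F⊑G x∈Nw) (y∉Nw ∘ N-ι⁻ F⊑G) (N-ι⁺ F⊑G a∈Nx) (N-ι⁺ F⊑G a∈Nv) (N-ι⁺ F⊑G b∈Ny) (N-ι⁺ F⊑G b∈Nv)))
    where
    im : ∀ {x} → S x → S′ (ι F⊑G x)
    im {x} x∈ = x , x∈ , refl

-- Optimal first moves

module _ (G : Graph n) (good : HereditarilyGood G) where

  -- The two P₃'s q u t and q′ u′ s are linked by the edge u u′.
  no-linked-P₃s : ∀ {q q′ u u′ s t} →
                  u ∈ N[ G ] u′ → q ∈ N[ G ] u → t ∈ N[ G ] u → q′ ∈ N[ G ] u′ → s ∈ N[ G ] u′ →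
                  q′ ∉ N[ G ] u → s ∉ N[ G ] u → q ∉ N[ G ] u′ → t ∉ N[ G ] u′ →
                  q′ ∉ N[ G ] q → t ∉ N[ G ] q → s ∉ N[ G ] q′ → ⊥
  no-linked-P₃s {q} {q′} {u} {u′} {s} {t} uu′ qu tu q′u′ su′ q′u s∉u q∉u′ t∉u′ q′∉q t∉q s∉q′ =
    let v , v∈ , separating , _ = good (List._∈ six) (λ x → DecMembership._∈?_ _≟_ x six) (q , q∈)
    in absurd v∈ separating
    where
    six : List (Fin n)
    six = q ∷ q′ ∷ u ∷ u′ ∷ s ∷ t ∷ []

    q∈ : q List.∈ six
    q∈ = here refl
    q′∈ : q′ List.∈ six
    q′∈ = there (here refl)
    u∈ : u List.∈ six
    u∈ = there (there (here refl))
    u′∈ : u′ List.∈ six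
    u′∈ = there (there (there (here refl)))
    s∈ : s List.∈ six
    s∈ = there (there (there (there (here refl))))
    t∈ : t List.∈ six
    t∈ = there (there (there (there (there (here refl)))))

    u′u : u′ ∈ N[ G ] u
    u′u = N-sym G uu′

    -- Each of the six vertices has two non-neighbours with a common closed neighbour that some
    -- other closed neighbourhood tells apart.
    absurd : ∀ {v} → v List.∈ six → SeparatingOn G (List._∈ six) v → ⊥
    absurd (here refl) sep =
      q′u (sep u′∈ q′∈ u′∈ u∈ (q∉u′ ∘ N-sym G) q′∉q (N-refl G u′) q′u′ u′u)
    absurd (there (here refl)) sep =
      q∉u′ (sep u∈ q∈ u∈ u′∈ (q′u ∘ N-sym G) (q′∉q ∘ N-sym G) (N-refl G u) qu uu′)
    absurd (there (there (here refl))) sep =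
      s∉q′ (sep q′∈ s∈ u′∈ q′∈ q′u s∉u q′u′ su′ (N-refl G q′))
    absurd (there (there (there (here refl)))) sep =
      t∉q (sep q∈ t∈ u∈ q∈ q∉u′ t∉u′ qu tu (N-refl G q))
    absurd (there (there (there (there (here refl))))) sep =
      q′u (sep u∈ q′∈ u′∈ u∈ (s∉u ∘ N-sym G) (s∉q′ ∘ N-sym G) uu′ q′u′ (N-refl G u))
    absurd (there (there (there (there (there (here refl)))))) sep =
      q∉u′ (sep u′∈ q∈ u∈ u′∈ (t∉u′ ∘ N-sym G) (t∉q ∘ N-sym G) u′u qu (N-refl G u′))

  good-vertex : ∃ λ v → Separating G v × Joined G v
  good-vertex with good (λ _ → ⊤₁) (λ _ → yes tt) (some-vertex G , tt)
  ... | v , _ , separatingOn , joinedOn = v , separating , joined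
    where
    separating : Separating G v
    separating x∉ y∉ x∈Nt y∈Nt = N-ext G
      (separatingOn tt tt tt tt x∉ y∉ x∈Nt y∈Nt) (separatingOn tt tt tt tt y∉ x∉ y∈Nt x∈Nt)

    distinguished : ∀ x y → Dec (∃ λ w → x ∈ N[ G ] w × y ∉ N[ G ] w)
    distinguished x y = any? λ w → (x ∈? N[ G ] w) ×-dec ¬? (y ∈? N[ G ] w)

    same : ∀ {x y} → ¬ (∃ λ w → x ∈ N[ G ] w × y ∉ N[ G ] w) → ∀ {w} → x ∈ N[ G ] w → y ∈ N[ G ] w
    same none x∈ = decidable-stable (_ ∈? _) λ y∉ → none (_ , x∈ , y∉)

    joined : Joined G v
    -- Inequality of the neighbourhoods does not say which has the extra element, so both directions
    -- are searched.
    joined {x} {y} x∉ y∉ Nx≢Ny a∈Nx a∈Nv b∈Ny b∈Nv with distinguished x y | distinguished y x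
    ... | yes (w , x∈ , y∉w) | _ = joinedOn tt tt tt tt tt x∉ y∉ x∈ y∉w a∈Nx a∈Nv b∈Ny b∈Nv
    ... | no _ | yes (w , y∈ , x∉w) = N-sym G (joinedOn tt tt tt tt tt y∉ x∉ y∈ x∉w b∈Ny b∈Nv a∈Nx a∈Nv)
    ... | no xy | no yx = contradiction (N-ext G (same xy) (same yx)) Nx≢Ny

-- No vertex dominates two members of `qs`, so the vertex dominating the first can be removed from
-- `D` and the rest is still dominated.
packing : (G : Graph n) {qs : List (Fin n)} → Unique qs →
          (∀ {q q′ t} → q List.∈ qs → q′ List.∈ qs → q ∈ N[ G ] t → q′ ∈ N[ G ] t → q ≡ q′) →
          ∀ {D} → (∀ {q} → q List.∈ qs → ∃ λ u → u ∈ D × q ∈ N[ G ] u) → length qs ≤ ∣ D ∣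
packing G [] _ _ = z≤n
packing G {q ∷ qs} (q∉ ∷ unique) apart {D} dom with dom (here refl)
... | u , u∈D , q∈Nu = ℕ.≤-trans (s≤s (packing G unique (λ p∈ p′∈ → apart (there p∈) (there p′∈)) dom′)) (x∈p⇒∣p-x∣<∣p∣ u∈D)
  where
  dom′ : ∀ {p} → p List.∈ qs → ∃ λ w → w ∈ D - u × p ∈ N[ G ] w
  dom′ p∈ with dom (there p∈)
  ... | w , w∈D , p∈Nw = w , x∈p∧x≢y⇒x∈p-y w∈D (λ { refl →
    All.lookup q∉ p∈ (apart (here refl) (there p∈) q∈Nu p∈Nw) }) , p∈Nw

module FirstMove (G : Graph n) (good : HereditarilyGood G)
                 (v : Fin n) (separating : Separating G v) (joined : Joined G v) where

  q? : ∀ x → Dec (x ∉ N[ G ] v × rep G x ≡ x)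
  q? x = ¬? (x ∈? N[ G ] v) ×-dec (rep G x ≟ x)

  -- One representative of each twin class avoiding `N[ G ] v`. Their number is a lower bound for
  -- `γ G` by `packing` and an upper bound for the moves following `v`.
  qs : List (Fin n)
  qs = filter q? (allFin n)

  qs-unique : Unique qs
  qs-unique = filter⁺ q? (allFin⁺ n)

  ∈-qs : ∀ {q} → q List.∈ qs → q ∉ N[ G ] v × rep G q ≡ q
  ∈-qs = proj₂ ∘ ∈-filter⁻ q? {xs = allFin n}

  cover : ∀ {x} → x ∉ N[ G ] v → rep G x List.∈ qs
  cover {x} x∉ = ∈-filter⁺ q? (∈-allFin _) ((λ r∈ → x∉ (N-≡ G (N-rep G x) r∈)) , rep-≡ G (N-rep G x))

  apart : ∀ {q q′ t} → q List.∈ qs → q′ List.∈ qs → q ∈ N[ G ] t → q′ ∈ N[ G ] t → q ≡ q′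
  apart q∈ q′∈ q∈Nt q′∈Nt =
    let q∉v , rq≡q = ∈-qs q∈ ; q′∉v , rq′≡q′ = ∈-qs q′∈
    in trans (sym rq≡q) (trans (rep-≡ G (separating q∉v q′∉v q∈Nt q′∈Nt)) rq′≡q′)

  after-move : ∀ u {ps} → (∀ {x} → x ∉ N[ G ] u → rep G x List.∈ ps) → γg G ≤ suc (length ps)
  after-move u {ps} cover′ =
    let b , γg≤ = γg≤1+gameLength G u
    in ℕ.≤-trans γg≤ (s≤s (gameLength≤length G b staller _ ps λ {x} x∉ →
         rep G x , cover′ (x∉ ∘ x∈p∪q⁺ ∘ inj₂) , sym (N-rep G x)))

  module Tight (D : Subset n) (dominating : Dominating G D) (∣D∣≤ : ∣ D ∣ ≤ length qs) where

    -- By `packing`, dominating `qs` takes at least `length qs` vertices, and `D - u` has fewer.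
    irredundant : ∀ {u} → u ∈ D → ¬ (∀ {q} → q List.∈ qs → ∃ λ w → w ∈ D - u × q ∈ N[ G ] w)
    irredundant u∈D dom =
      ℕ.<⇒≱ (x∈p⇒∣p-x∣<∣p∣ u∈D) (ℕ.≤-trans ∣D∣≤ (packing G qs-unique apart dom))

    near : ∀ {u} → u ∈ D → ∃ λ q → q List.∈ qs × q ∈ N[ G ] u
    near {u} u∈D with any? (λ q → q? q ×-dec (q ∈? N[ G ] u))
    ... | yes (q , q-ok , q∈Nu) = q , ∈-filter⁺ q? (∈-allFin q) q-ok , q∈Nu
    ... | no  none = ⊥-elim (irredundant u∈D λ {q} q∈ →
      let w , w∈D , q∈Nw = dominating q
      in w , x∈p∧x≢y⇒x∈p-y w∈D (λ { refl → none (q , ∈-qs q∈ , q∈Nw) }) , q∈Nw)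

    unique-dominator : ∀ {q u w} → q List.∈ qs → u ∈ D → w ∈ D → q ∈ N[ G ] u → q ∈ N[ G ] w → u ≡ w
    unique-dominator {q} {u} {w} q∈ u∈D w∈D q∈Nu q∈Nw = decidable-stable (u ≟ w) λ u≢w →
      irredundant w∈D λ {p} p∈ → dom u≢w p∈ (dominating p)
      where
      dom : u ≢ w → ∀ {p} → p List.∈ qs → (∃ λ z → z ∈ D × p ∈ N[ G ] z) → ∃ λ z → z ∈ D - w × p ∈ N[ G ] z
      dom u≢w p∈ (z , z∈D , p∈Nz) with z ≟ w
      ... | no  z≢w  = z , x∈p∧x≢y⇒x∈p-y z∈D z≢w , p∈Nz
      ... | yes refl = u , x∈p∧x≢y⇒x∈p-y u∈D u≢w , subst (_∈ N[ G ] u) (apart q∈ p∈ q∈Nw p∈Nz) q∈Nu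

    f : Fin n → ℕ
    f u = ∣ N[ G ] u ∩ N[ G ] v ∣

    candidate? : ∀ u → Dec (u ∈ D × u ∈ N[ G ] v)
    candidate? u = (u ∈? D) ×-dec (u ∈? N[ G ] v)

    module _ {u} (u∈D : u ∈ D) (u∈Nv : u ∈ N[ G ] v)
             (maximal : ∀ {w} → w ∈ D → w ∈ N[ G ] v → f w ≤ f u) where

      -- A neighbour s of v missed by u, dominated by u′ say, yields a pair of
      -- linked P₃'s, as u has by maximality a neighbour t in N[v] missed by u′.
      Nv⊆Nu : N[ G ] v ⊆ N[ G ] u
      Nv⊆Nu {s} s∈Nv = decidable-stable (s ∈? N[ G ] u) λ s∉Nu → absurd s∉Nu (dominating s) (near u∈D)
        where
        absurd : s ∉ N[ G ] u → (∃ λ u′ → u′ ∈ D × s ∈ N[ G ] u′) → (∃ λ q → q List.∈ qs × q ∈ N[ G ] u) → ⊥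
        absurd s∉Nu (u′ , u′∈D , s∈Nu′) (q , q∈ , q∈Nu) = go (near u′∈D)
          where
          go : (∃ λ q′ → q′ List.∈ qs × q′ ∈ N[ G ] u′) → ⊥
          go (q′ , q′∈ , q′∈Nu′) = finish (any? λ t → (t ∈? (N[ G ] u ∩ N[ G ] v)) ×-dec ¬? (t ∈? N[ G ] u′))
            where
            u≢u′ : u ≢ u′
            u≢u′ refl = s∉Nu s∈Nu′

            q≢q′ : q ≢ q′
            q≢q′ refl = u≢u′ (unique-dominator q∈ u∈D u′∈D q∈Nu q′∈Nu′)

            disjoint : ∀ {t} → q ∈ N[ G ] t → q′ ∈ N[ G ] t → ⊥
            disjoint q∈Nt q′∈Nt = q≢q′ (apart q∈ q′∈ q∈Nt q′∈Nt)

            Nq≢Nq′ : N[ G ] q ≢ N[ G ] q′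
            Nq≢Nq′ eq = disjoint (N-refl G q) (N-≡ G eq (N-refl G q))

            link : ∀ {a b} → a ∈ N[ G ] q → a ∈ N[ G ] v → b ∈ N[ G ] q′ → b ∈ N[ G ] v → b ∈ N[ G ] a
            link = joined (proj₁ (∈-qs q∈)) (proj₁ (∈-qs q′∈)) Nq≢Nq′

            s∉Nq′ : s ∉ N[ G ] q′
            s∉Nq′ s∈Nq′ = s∉Nu (link (N-sym G q∈Nu) u∈Nv s∈Nq′ s∈Nv)

            -- Otherwise `u′` would be a twin of `q′`, and `s` a closed neighbour of `q′`.
            u′∈Nv : u′ ∈ N[ G ] v
            u′∈Nv = decidable-stable (u′ ∈? N[ G ] v) λ u′∉Nv → s∉Nq′
              (subst (s ∈_) (separating u′∉Nv (proj₁ (∈-qs q′∈)) (N-refl G u′) q′∈Nu′) s∈Nu′)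

            u′∈Nu : u′ ∈ N[ G ] u
            u′∈Nu = link (N-sym G q∈Nu) u∈Nv (N-sym G q′∈Nu′) u′∈Nv

            finish : Dec (∃ λ t → t ∈ N[ G ] u ∩ N[ G ] v × t ∉ N[ G ] u′) → ⊥
            finish (yes (t , t∈ , t∉Nu′)) =
              let t∈Nu , t∈Nv = x∈p∩q⁻ (N[ G ] u) _ t∈
              in no-linked-P₃s G good (N-sym G u′∈Nu) q∈Nu t∈Nu q′∈Nu′ s∈Nu′
                   (disjoint q∈Nu) s∉Nu (λ q∈Nu′ → disjoint q∈Nu′ q′∈Nu′) t∉Nu′
                   (disjoint (N-refl G q))
                   (λ t∈Nq → t∉Nu′ (N-sym G (link t∈Nq t∈Nv (N-sym G q′∈Nu′) u′∈Nv))) s∉Nq′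
            -- Here `u′` sees all of `N[ G ] u ∩ N[ G ] v` and also `s`, against the maximality of
            -- `u`.
            finish (no none) = ℕ.<⇒≱ (p⊂q⇒∣p∣<∣q∣
              ( (λ {t} t∈ → x∈p∩q⁺ ( decidable-stable (t ∈? N[ G ] u′) (λ t∉ → none (t , t∈ , t∉))
                                   , proj₂ (x∈p∩q⁻ (N[ G ] u) _ t∈)))
              , s , x∈p∩q⁺ (s∈Nu′ , s∈Nv) , s∉Nu ∘ proj₁ ∘ x∈p∩q⁻ (N[ G ] u) _))
              (maximal u′∈D u′∈Nv)

      -- The move `u` dominates `N[ G ] v` and the class of `q`, leaving one class fewer than after
      -- `v`.
      γg≤length : γg G ≤ length qs
      γg≤length with near u∈D
      ... | q , q∈ , q∈Nu = ℕ.≤-trans (after-move u cover′) (List.filter-notAll other? qs (List.lose q∈ λ q≢q → q≢q refl))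
        where
        other? : ∀ p → Dec (p ≢ q)
        other? p = ¬? (p ≟ q)
        cover′ : ∀ {x} → x ∉ N[ G ] u → rep G x List.∈ filter other? qs
        cover′ {x} x∉ = ∈-filter⁺ other? (cover (x∉ ∘ Nv⊆Nu))
          λ { refl → x∉ (N-≡ G (N-rep G x) q∈Nu) }

  γg≤γ : γg G ≤ γ G
  γg≤γ = let D , dominating , ∣D∣≡γ = γ-attained G in compare D dominating ∣D∣≡γ (∣ D ∣ ℕ.≤? length qs)
    where
    compare : ∀ D → Dominating G D → ∣ D ∣ ≡ γ G → Dec (∣ D ∣ ≤ length qs) → γg G ≤ γ G
    compare D dominating ∣D∣≡γ (no ∣D∣≰) =
      -- Here `γ G` exceeds the number of classes, which pays for the move `v` itself.
      ℕ.≤-trans (after-move v cover) (ℕ.≤-trans (ℕ.≰⇒> ∣D∣≰) (ℕ.≤-reflexive ∣D∣≡γ))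
    compare D dominating ∣D∣≡γ (yes ∣D∣≤) =
      -- The member of `D` dominating `v` shows that there is a candidate to maximize over.
      let u₀ , u₀∈D , v∈Nu₀ = dominating v
          u , u∈ , maximal = maximum-∈ f (∈-filter⁺ candidate? (∈-allFin u₀) (u₀∈D , N-sym G v∈Nu₀))
          u∈D , u∈Nv = proj₂ (∈-filter⁻ candidate? {xs = allFin n} u∈)
      in ℕ.≤-trans (γg≤length u∈D u∈Nv λ w∈D w∈Nv → maximal (∈-filter⁺ candidate? (∈-allFin _) (w∈D , w∈Nv)))
           (ℕ.≤-trans (packing G qs-unique apart λ {q} _ → dominating q) (ℕ.≤-reflexive ∣D∣≡γ))
      where open Tight D dominating ∣D∣≤

hereditarilyGood⇒perfect : {G : Graph n} → HereditarilyGood G → γg-Perfect G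
hereditarilyGood⇒perfect good F F⊑G =
  let good-F = hereditarilyGood-⊑ F⊑G good
      v , separating , joined = good-vertex F good-F
  in ℕ.≤-antisym (FirstMove.γg≤γ F good-F v separating joined) (γ≤γg F)

theorem3p7 : ∀ {n} (G : Graph n) → (γg-Perfect G ⇔ 2-γg-Perfect G) × (2-γg-Perfect G ⇔ Constructible G)
theorem3p7 G =
  mk⇔ perfect⇒2-perfect (constructible⇒perfect ∘ 2-perfect⇒constructible G) ,
  mk⇔ (2-perfect⇒constructible G) (perfect⇒2-perfect ∘ constructible⇒perfect)
  where
  perfect⇒2-perfect : γg-Perfect G → 2-γg-Perfect G
  perfect⇒2-perfect perfect F F⊑G γ≡2 = trans (perfect F F⊑G) γ≡2

  constructible⇒perfect : Constructible G → γg-Perfect G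
  constructible⇒perfect = hereditarilyGood⇒perfect ∘ constructible⇒hereditarilyGood
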